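{- Let $k\ge 1$, let $\mathbf F$ be a satisfiable $k$-CNF formula on $n$ variables with set of satisfying assignments $\Omega_{\mathbf F}\subseteq\{0,1\}^n$, and let $z_0\in\{0,1\}^n$ be arbitrary. Then a single iteration of the PPZ algorithm on $\mathbf F$ (which does not depend on $z_0$) outputs, with probability at least $\frac{1}{2n}\cdot 2^{ -(1-1/k)n}$, a satisfying assignment $z^*\in\Omega_{\mathbf F}$ such that $$d_H(z_0,z^*)\ \ge\ \left(1-\frac1k\right)\cdot\max_{z'\in\Omega_{\mathbf F}} d_H(z_0,z').$$
   Context: $d_H$ is Hamming distance on $\{0,1\}^n$. A $k$-CNF formula is a conjunction of clauses, each a disjunction of at most $k$ literals. One iteration of the PPZ algorithm on $\mathbf F$: sample $y\in\{0,1\}^n$ and a permutation $\pi\in S_n$ uniformly and independently. Set $\mathbf F_0=\mathbf F$. For $i=1,\dots,n$: if $\mathbf F_{i-1}$ contains the unit clause $(x_{\pi(i)})$, set $u_{\pi(i)}=1$; otherwise, if it contains the unit clause $(\overline{x_{\pi(i)}})$, set $u_{\pi(i)}=0$; otherwise set $u_{\pi(i)}=y_{\pi(i)}$. Then let $\mathbf F_i$ be $\mathbf F_{i-1}$ with $x_{\pi(i)}$ replaced by the value $u_{\pi(i)}$ (satisfied clauses are removed and false literals are deleted from clauses). The iteration outputs $u=(u_1,\dots,u_n)$. -}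

module Defs where

import Algebra.Definitions.RawSemiring
open import Data.Bool.Base using (Bool; true; false; not; _xor_)
import Data.Bool.Properties as Bool
open import Data.Fin.Base using (Fin)
import Data.Fin.Properties as Fin
open import Data.Fin.Subset using (Subset; ⊥; ⁅_⁆; _∈_; _-_; ∣_∣)
open import Data.Fin.Subset.Properties using (_∈?_)
open import Data.Integer.Base using (+_)
open import Data.List.Base using (List; []; _∷_; map; filter; length; allFin; cartesianProduct; cartesianProductWith)
open import Data.List.Extrema.Nat using (max)
import Data.List.Membership.DecPropositional as DecMembership
open import Data.List.Relation.Unary.All using (All; all?)
open import Data.Nat.Base using (ℕ; zero; suc; _≤_; NonZero)
import Data.Nat.Base as ℕ
open import Data.Product.Base using (∃; _×_; _,_)
open import Data.Rational.Base as ℚ using (ℚ; 0ℚ; 1ℚ; ½; _/_; +-*-rawSemiring)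
import Data.Rational.Properties as ℚ
open import Data.Vec.Base using (Vec; []; _∷_; lookup; zipWith; _[_]≔_)
import Data.Vec.Properties as Vec
open import Data.Vec.Relation.Unary.AllPairs using (allPairs?)
open import Data.Vec.Relation.Unary.Unique.Propositional using (Unique)
open import Level using (0ℓ)
open import Relation.Binary.Definitions using (DecidableEquality)
open import Relation.Binary.PropositionalEquality using (_≡_; refl; cong)
open import Relation.Nullary using (Dec; yes; no; ¬?; _×-dec_)
open import Relation.Nullary.Decidable using (map′)
open import Relation.Unary using (Pred; Decidable)

open Algebra.Definitions.RawSemiring +-*-rawSemiring public using () renaming (_^_ to _^ℚ_)

private
  variable
    n m : ℕ

Assignment : ℕ → Set
Assignment n = Vec Bool n

d-H : Assignment n → Assignment n → ℕ
d-H x y = ∣ zipWith _xor_ x y ∣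

-- A clause is a set of literals: x_i occurs in it when i ∈ pos, and ¬x_i
-- when i ∈ neg.
record Clause (n : ℕ) : Set where
  constructor clause
  field
    pos neg : Subset n

open Clause public

-- The variables whose literal made true by the value b occurs in the clause.
lits : Bool → Clause n → Subset n
lits true  = pos
lits false = neg

width : Clause n → ℕ
width C = ∣ pos C ∣ ℕ.+ ∣ neg C ∣

-- The one-literal clause satisfied exactly when variable i has value b.
unit : Bool → Fin n → Clause n
unit true  i = clause ⁅ i ⁆ ⊥
unit false i = clause ⊥ ⁅ i ⁆

_≟ᶜ_ : DecidableEquality (Clause n)
clause p q ≟ᶜ clause p′ q′ =
  map′ (λ { (refl , refl) → refl }) (λ e → cong pos e , cong neg e)
       (Vec.≡-dec Bool._≟_ p p′ ×-dec Vec.≡-dec Bool._≟_ q q′)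

CNF : ℕ → Set
CNF n = List (Clause n)

IsKCNF : ℕ → CNF n → Set
IsKCNF k = All (λ C → width C ≤ k)

infix 4 _⊨ᶜ_ _⊨_ _⊨ᶜ?_ _⊨?_

_⊨ᶜ_ : Assignment n → Clause n → Set
z ⊨ᶜ C = ∃ λ i → i ∈ lits (lookup z i) C

_⊨_ : Assignment n → CNF n → Set
z ⊨ F = All (z ⊨ᶜ_) F

Satisfiable : CNF n → Set
Satisfiable F = ∃ λ z → z ⊨ F

_⊨ᶜ?_ : (z : Assignment n) → Decidable (z ⊨ᶜ_)
z ⊨ᶜ? C = Fin.any? λ i → i ∈? lits (lookup z i) C

_⊨?_ : (z : Assignment n) → Decidable (z ⊨_)
z ⊨? F = all? (z ⊨ᶜ?_) F

allVecs : {A : Set} → List A → (n : ℕ) → List (Vec A n)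
allVecs xs zero    = [] ∷ []
allVecs xs (suc n) = cartesianProductWith _∷_ xs (allVecs xs n)

allAssignments : (n : ℕ) → List (Assignment n)
allAssignments = allVecs (false ∷ true ∷ [])

-- Permutations in one-line notation, π(1) … π(n).
allPermutations : (n : ℕ) → List (Vec (Fin n) n)
allPermutations n = filter (allPairs? (λ i j → ¬? (i Fin.≟ j))) (allVecs (allFin n) n)

Ω : CNF n → List (Assignment n)
Ω {n} F = filter (_⊨? F) (allAssignments n)

-- The default value 0 is immaterial when F is satisfiable.
maxDist : CNF n → Assignment n → ℕ
maxDist F z₀ = max 0 (map (d-H z₀) (Ω F))

deleteFalse : Fin n → Bool → Clause n → Clause n
deleteFalse i true  (clause p q) = clause p (q - i)
deleteFalse i false (clause p q) = clause (p - i) q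

infix 30 _[_:=_]

_[_:=_] : CNF n → Fin n → Bool → CNF n
F [ i := b ] = map (deleteFalse i b) (filter (λ C → ¬? (i ∈? lits b C)) F)

choose : CNF n → Fin n → Bool → Bool
choose F i yᵢ with unit true i ∈CNF? F | unit false i ∈CNF? F
  where open DecMembership _≟ᶜ_ renaming (_∈?_ to _∈CNF?_)
... | yes _ | _     = true
... | no _  | yes _ = false
... | no _  | no _  = yᵢ

-- Processes the variables listed in the vector from left to right; as the
-- entries of a permutation are distinct and exhaust Fin n, the base value y
-- is then overwritten at every coordinate, once.
ppz : CNF n → Assignment n → Vec (Fin n) m → Assignment n
ppz F y []      = y
ppz F y (i ∷ π) = ppz (F [ i := b ]) y π [ i ]≔ b
  where b = choose F i (lookup y i)

Sample : ℕ → Set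
Sample n = Assignment n × Vec (Fin n) n

samples : (n : ℕ) → List (Sample n)
samples n = cartesianProduct (allAssignments n) (allPermutations n)

-- Probability of P under the uniform distribution on the entries of a
-- duplicate-free list (0 by convention for the empty list).
Pr : {A : Set} {P : Pred A 0ℓ} → List A → Decidable P → ℚ
Pr []          P? = 0ℚ
Pr xs@(_ ∷ _) P? = + length (filter P? xs) / length xs

Good : (k : ℕ) .{{_ : NonZero k}} → CNF n → Assignment n → Pred (Assignment n) 0ℓ
Good k F z₀ z* =
  z* ⊨ F × (1ℚ ℚ.- + 1 / k) ℚ.* (+ maxDist F z₀ / 1) ℚ.≤ + d-H z₀ z* / 1

good? : (k : ℕ) .{{_ : NonZero k}} (F : CNF n) (z₀ : Assignment n) → Decidable (Good k F z₀)
good? k F z₀ z* = (z* ⊨? F) ×-dec (_ ℚ.≤? _)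

PrPPZ : {P : Pred (Assignment n) 0ℓ} → CNF n → Decidable P → ℚ
PrPPZ {n} F P? = Pr (samples n) λ (y , π) → P? (ppz F y π)

-- p ≥ c · 2^(-a/b), for p, c ≥ 0: as the real number 2^(-a/b) may be
-- irrational, both sides are raised to the b-th power.
infix 4 _≥_·2^-[_/_]

_≥_·2^-[_/_] : ℚ → ℚ → (a b : ℕ) .{{_ : NonZero b}} → Set
p ≥ c ·2^-[ a / b ] = (c ^ℚ b) ℚ.* (½ ^ℚ a) ℚ.≤ p ^ℚ b

module Submission where

-- Let z be a satisfying assignment with m satisfying neighbours. In each of the
-- other n ∸ m directions i some clause is satisfied by z through variable i only,
-- and i is forced whenever it comes last among the at most k variables of that
-- clause, so with probability at least 1/k. By AM-GM, PPZ outputs z with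
-- probability at least 2 ^ (-n + (n - m) / k), and it remains to bound from below
-- the sum of 2 ^ (-m / k) over the z at distance at least D ∸ r from z₀, where D is
-- the maximal distance and r = ⌊D / k⌋.
-- If an assignment z′ at distance D has no neighbour, its term is 1. Otherwise it
-- has a neighbour in some direction i, necessarily closer to z₀; split the
-- assignments by their i-th value. Each loses at most one neighbour, z′ is left with
-- one direction less to descend, and the maximal distance in the other half is D
-- or D ∸ 1. By induction the sum is at least 2 ^ (-(D ∸ k r) / k), where now D
-- counts only the directions not yet fixed: if D > k r, the half of z′ suffices;
-- otherwise (x + y)² ≥ 4 x y combines the halves. For r = ⌊D / k⌋ the bound exceeds
-- 1/2. All estimates are raised to the k-th power, so that only integral powers of 2
-- occur.

open import Defs
open import Data.Nat.Base using (ℕ; NonZero; _*_; _∸_)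
open import Data.Nat.Properties using (m*n≢0)

open import Data.Bool.Base using (Bool; true; false; not; if_then_else_; _xor_)
import Data.Bool.Properties as Bool
import Data.Empty as Empty
open import Data.Fin.Base using (Fin; zero; suc; punchOut)
open import Data.Fin.Permutation.Components using (transpose; transpose-inverse)
import Data.Fin.Properties as Fin
open import Data.Fin.Subset using (Subset; inside; outside; ⊥; ⁅_⁆; _∈_; _∉_; _⊆_; _∪_; _-_; ∣_∣; ∁)
open import Data.Fin.Subset.Properties
import Data.Integer.Base as ℤ
import Data.Integer.Properties as ℤ
open import Data.List.Base using (List; []; _∷_; _++_; map; length; filter; allFin; cartesianProductWith) renaming (tabulate to tabulateᴸ)
open import Data.List.Extrema.Nat using (argmax; argmax-sel; f[xs]≤f[argmax]; max≤v⁺)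
import Data.List.Membership.DecPropositional as DecMembership
import Data.List.Membership.Propositional as List
import Data.List.Membership.Propositional.Properties as List
open import Data.List.Membership.Propositional.Properties.WithK using (unique∧set⇒bag)
import Data.List.Properties as List
open import Data.List.Relation.Binary.BagAndSetEquality using (∼bag⇒↭)
open import Data.List.Relation.Binary.Permutation.Propositional using (_↭_)
import Data.List.Relation.Binary.Permutation.Propositional.Properties as ↭
open import Data.List.Relation.Unary.All using ([]; _∷_)
import Data.List.Relation.Unary.All as All
import Data.List.Relation.Unary.All.Properties as All
open import Data.List.Relation.Unary.AllPairs using ([]; _∷_)
open import Data.List.Relation.Unary.Any using (here; there)
import Data.List.Relation.Unary.Any as Any
import Data.List.Relation.Unary.Unique.Propositional as List
import Data.List.Relation.Unary.Unique.Propositional.Properties as UniqueList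
open import Data.Nat.Base hiding (_/_; _≥_)
import Data.Nat.Base as ℕ
open import Data.Nat.DivMod using (m≡m%n+[m/n]*n; m%n<n; m/n≤m; m/n*n≤m)
open import Data.Nat.ListAction using (sum; product)
open import Data.Nat.ListAction.Properties using (sum-++; sum-↭)
open import Data.Nat.Properties
open import Data.Nat.Tactic.RingSolver using (solve-∀)
open import Data.Product.Base using (∃; _×_; _,_; proj₁; proj₂)
open import Data.Rational.Base as ℚ using (1ℚ; ½; toℚᵘ)
import Data.Rational.Properties as ℚ
open import Data.Rational.Unnormalised.Base as ℚᵘ using (mkℚᵘ; *≤*; *≡*)
import Data.Rational.Unnormalised.Properties as ℚᵘ
open import Data.Sum.Base using (_⊎_; inj₁; inj₂; [_,_]′)
open import Data.Vec.Base using (Vec; []; _∷_; lookup; here; there; tabulate; updateAt; zipWith)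
import Data.Vec.Base as Vec
import Data.Vec.Membership.Propositional as VecM
import Data.Vec.Membership.Propositional.Properties as VecM
import Data.Vec.Properties as Vec
import Data.Vec.Relation.Unary.All as VecAll
import Data.Vec.Relation.Unary.All.Properties as VecAll
open import Data.Vec.Relation.Unary.AllPairs using ([]; _∷_; allPairs?)
import Data.Vec.Relation.Unary.Any as VecAny
open import Data.Vec.Relation.Unary.Unique.Propositional using (Unique)
import Data.Vec.Relation.Unary.Unique.Propositional.Properties as UniqueVec
open import Function.Base using (_∘_; id; const)
open import Function.Bundles using (mk⇔)
open import Level using (0ℓ)
open import Relation.Binary.Definitions using (DecidableEquality)
open import Relation.Binary.PropositionalEquality
open import Relation.Nullary using (Dec; yes; no; ¬_; ¬?; does; contradiction; _×-dec_)
open import Relation.Nullary.Decidable using (map′; dec-true)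
open import Relation.Unary using (Pred; Decidable)

open import Algebra.Properties.CommutativeSemigroup +-commutativeSemigroup using (x∙yz≈y∙xz; interchange)

private
  variable
    A B C P Q : Set
    m n : ℕ

-- Inequalities in ℕ

^-cancelˡ-≤ : ∀ n .{{_ : NonZero n}} {x y} → x ^ n ≤ y ^ n → x ≤ y
^-cancelˡ-≤ n {x} {y} xⁿ≤yⁿ with x ≤? y
... | yes x≤y = x≤y
... | no  x≰y = contradiction xⁿ≤yⁿ (<⇒≱ (^-monoˡ-< n (≰⇒> x≰y)))

^-distribʳ-* : ∀ k m n → (m * n) ^ k ≡ m ^ k * n ^ k
^-distribʳ-* zero    m n = refl
^-distribʳ-* (suc k) m n = trans (cong (m * n *_) (^-distribʳ-* k m n)) (eq m n (m ^ k) (n ^ k))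
  where
  eq : ∀ m n p q → m * n * (p * q) ≡ m * p * (n * q)
  eq = solve-∀

2xy≤x²+y² : ∀ x y → 2 * (x * y) ≤ x * x + y * y
2xy≤x²+y² x y with ≤-total x y
... | inj₁ x≤y with d , refl ← m≤n⇒∃[o]m+o≡n x≤y = begin
  2 * (x * (x + d))          ≤⟨ m≤m+n _ (d * d) ⟩
  2 * (x * (x + d)) + d * d  ≡⟨ eq x d ⟩
  x * x + (x + d) * (x + d)  ∎
  where
  open ≤-Reasoning
  eq : ∀ x d → 2 * (x * (x + d)) + d * d ≡ x * x + (x + d) * (x + d)
  eq = solve-∀
... | inj₂ y≤x with d , refl ← m≤n⇒∃[o]m+o≡n y≤x = begin
  2 * ((y + d) * y)          ≤⟨ m≤m+n _ (d * d) ⟩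
  2 * ((y + d) * y) + d * d  ≡⟨ eq y d ⟩
  (y + d) * (y + d) + y * y  ∎
  where
  open ≤-Reasoning
  eq : ∀ y d → 2 * ((y + d) * y) + d * d ≡ (y + d) * (y + d) + y * y
  eq = solve-∀

-- Convexity: the graph of the power `suc m` lies above its tangent line at `x`, with the terms
-- arranged to avoid subtraction. The induction step combines `y` times the previous case with
-- `2xy≤x²+y²`; the surplus `m * (x ^ m * x * y)` is added to both sides and cancelled.
tangent : ∀ m x y → suc m * (x ^ m * y) ≤ y ^ suc m + m * x ^ suc m
tangent zero x y = ≤-reflexive (eq y)
  where
  eq : ∀ y → 1 * (1 * y) ≡ y * 1 + 0
  eq = solve-∀
tangent (suc m) x y = +-cancelʳ-≤ (m * (x ^ m * x * y)) _ _ (begin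
  suc (suc m) * (x * x ^ m * y) + m * (x ^ m * x * y)          ≡⟨ eq₁ m (x ^ m) x y ⟩
  suc m * x ^ m * (2 * (x * y))                                ≤⟨ *-monoʳ-≤ (suc m * x ^ m) (2xy≤x²+y² x y) ⟩
  suc m * x ^ m * (x * x + y * y)                              ≡⟨ eq₂ m (x ^ m) x y ⟩
  y * (suc m * (x ^ m * y)) + suc m * (x * (x * x ^ m))        ≤⟨ +-monoˡ-≤ _ (*-monoʳ-≤ y (tangent m x y)) ⟩
  y * (y ^ suc m + m * x ^ suc m) + suc m * (x * (x * x ^ m))  ≡⟨ eq₃ m (x ^ m) (y ^ suc m) x y ⟩
  y ^ suc (suc m) + suc m * x ^ suc (suc m) + m * (x ^ m * x * y) ∎)
  where
  open ≤-Reasoning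
  eq₁ : ∀ m p x y → suc (suc m) * (x * p * y) + m * (p * x * y) ≡ suc m * p * (2 * (x * y))
  eq₁ = solve-∀
  eq₂ : ∀ m p x y → suc m * p * (x * x + y * y) ≡ y * (suc m * (p * y)) + suc m * (x * (x * p))
  eq₂ = solve-∀
  eq₃ : ∀ m p q x y → y * (q + m * (x * p)) + suc m * (x * (x * p)) ≡ y * q + suc m * (x * (x * p)) + m * (p * x * y)
  eq₃ = solve-∀

-- The tangent line at x = (N+1) s, evaluated at y = N (s + a).
am-gm-step : ∀ N .{{_ : NonZero N}} s a → suc N ^ suc N * (s ^ N * a) ≤ (s + a) ^ suc N * N ^ N
am-gm-step N s a = *-cancelˡ-≤ N (+-cancelʳ-≤ (N * x ^ suc N) _ _ (begin
  N * (suc N ^ suc N * (s ^ N * a)) + N * x ^ suc N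
    ≡⟨ cong (λ p → N * (suc N ^ suc N * (s ^ N * a)) + N * (x * p)) (^-distribʳ-* N (suc N) s) ⟩
  N * (suc N ^ suc N * (s ^ N * a)) + N * (suc N * s * (suc N ^ N * s ^ N))
    ≡⟨ eq₁ N (suc N ^ N) (s ^ N) s a ⟩
  suc N * ((suc N ^ N * s ^ N) * (N * (s + a)))
    ≡⟨ cong (λ p → suc N * (p * (N * (s + a)))) (^-distribʳ-* N (suc N) s) ⟨
  suc N * (x ^ N * (N * (s + a)))
    ≤⟨ tangent N x (N * (s + a)) ⟩
  (N * (s + a)) ^ suc N + N * x ^ suc N
    ≡⟨ cong (_+ N * x ^ suc N) (^-distribʳ-* (suc N) N (s + a)) ⟩
  N ^ suc N * (s + a) ^ suc N + N * x ^ suc N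
    ≡⟨ cong (_+ N * x ^ suc N) (eq₂ N (N ^ N) ((s + a) ^ suc N)) ⟩
  N * ((s + a) ^ suc N * N ^ N) + N * x ^ suc N  ∎))
  where
  open ≤-Reasoning
  x = suc N * s
  eq₁ : ∀ N p q s a → N * (suc N * p * (q * a)) + N * (suc N * s * (p * q)) ≡ suc N * ((p * q) * (N * (s + a)))
  eq₁ = solve-∀
  eq₂ : ∀ N p q → N * p * q ≡ N * (q * p)
  eq₂ = solve-∀

-- The means are compared without roots or division. One entry is added at a time to a non-empty
-- tail, and the factor `N ^ N` belonging to that tail is multiplied in and cancelled.
am-gm : ∀ as → length as ^ length as * product as ≤ sum as ^ length as
am-gm [] = ≤-refl
am-gm (a ∷ []) = ≤-reflexive (eq a)
  where
  eq : ∀ a → 1 * (a * 1) ≡ (a + 0) * 1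
  eq = solve-∀
am-gm (a ∷ as@(_ ∷ _)) = *-cancelʳ-≤ _ _ (N ^ N) {{m^n≢0 N N}} (begin
  suc N ^ suc N * (a * product as) * N ^ N  ≡⟨ eq (suc N ^ suc N) a (product as) (N ^ N) ⟩
  suc N ^ suc N * (N ^ N * product as * a)  ≤⟨ *-monoʳ-≤ (suc N ^ suc N) (*-monoˡ-≤ a (am-gm as)) ⟩
  suc N ^ suc N * (sum as ^ N * a)          ≤⟨ am-gm-step N (sum as) a ⟩
  (sum as + a) ^ suc N * N ^ N              ≡⟨ cong (λ s → s ^ suc N * N ^ N) (+-comm (sum as) a) ⟩
  (a + sum as) ^ suc N * N ^ N              ∎)
  where
  open ≤-Reasoning
  N = length as
  eq : ∀ p a b q → p * (a * b) * q ≡ p * (q * b * a)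
  eq = solve-∀

∑ : List A → (A → ℕ) → ℕ
∑ xs f = sum (map f xs)

product-2^ : (f : A → ℕ) (xs : List A) → product (map (λ x → 2 ^ f x) xs) ≡ 2 ^ ∑ xs f
product-2^ f []       = refl
product-2^ f (x ∷ xs) = trans (cong (2 ^ f x *_) (product-2^ f xs)) (sym (^-distribˡ-+-* 2 (f x) (∑ xs f)))

^-comm : ∀ x m n → (x ^ m) ^ n ≡ (x ^ n) ^ m
^-comm x m n = trans (^-*-assoc x m n) (trans (cong (x ^_) (*-comm m n)) (sym (^-*-assoc x n m)))

-- Jensen's inequality for the exponential: if `f` averages at least `I / k`, the mean of `2 ^ f x`
-- is at least 2 to the power `I / k`. It is AM-GM for the numbers `2 ^ f x`, whose product is a
-- power of 2; roots of order `N` and `k` are avoided by taking powers.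
2^-jensen : ∀ k I (f : A → ℕ) (xs : List A) .{{_ : NonZero (length xs)}} →
            length xs * I ≤ k * ∑ xs f →
            length xs ^ k * 2 ^ I ≤ ∑ xs (λ x → 2 ^ f x) ^ k
2^-jensen k I f xs NI≤k∑f = ^-cancelˡ-≤ N (begin
  (N ^ k * 2 ^ I) ^ N                       ≡⟨ ^-distribʳ-* N (N ^ k) (2 ^ I) ⟩
  (N ^ k) ^ N * (2 ^ I) ^ N                 ≡⟨ cong₂ _*_ (^-comm N k N) (^-*-assoc 2 I N) ⟩
  (N ^ N) ^ k * 2 ^ (I * N)
    ≤⟨ *-monoʳ-≤ ((N ^ N) ^ k) (^-monoʳ-≤ 2 (subst₂ _≤_ (*-comm N I) (*-comm k (∑ xs f)) NI≤k∑f)) ⟩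
  (N ^ N) ^ k * 2 ^ (∑ xs f * k)            ≡⟨ cong ((N ^ N) ^ k *_) (^-*-assoc 2 (∑ xs f) k) ⟨
  (N ^ N) ^ k * (2 ^ ∑ xs f) ^ k            ≡⟨ ^-distribʳ-* k (N ^ N) (2 ^ ∑ xs f) ⟨
  (N ^ N * 2 ^ ∑ xs f) ^ k
    ≡⟨ cong₂ (λ l p → (l ^ l * p) ^ k) (List.length-map (λ x → 2 ^ f x) xs) (product-2^ f xs) ⟨
  (length as ^ length as * product as) ^ k  ≤⟨ ^-monoˡ-≤ k (am-gm as) ⟩
  (sum as ^ length as) ^ k                  ≡⟨ cong (λ l → (sum as ^ l) ^ k) (List.length-map (λ x → 2 ^ f x) xs) ⟩
  (sum as ^ N) ^ k                          ≡⟨ ^-comm (sum as) N k ⟩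
  (sum as ^ k) ^ N                          ∎)
  where
  open ≤-Reasoning
  N = length xs
  as = map (λ x → 2 ^ f x) xs

-- From 4xy ≤ (x + y)².
merge : ∀ {B x y} k a b c → B ≤ x ^ k * 2 ^ a → B ≤ y ^ k * 2 ^ b → a + b ≤ 2 * k + 2 * c →
        B ≤ (x + y) ^ k * 2 ^ c
merge {B} {x} {y} k a b c B≤X B≤Y a+b≤ = ^-cancelˡ-≤ 2 (begin
  B ^ 2                                      ≡⟨ cong (B *_) (*-identityʳ B) ⟩
  B * B                                      ≤⟨ *-mono-≤ B≤X B≤Y ⟩
  (x ^ k * 2 ^ a) * (y ^ k * 2 ^ b)          ≡⟨ eq₁ (x ^ k) (2 ^ a) (y ^ k) (2 ^ b) ⟩
  (x ^ k * y ^ k) * (2 ^ a * 2 ^ b)          ≡⟨ cong₂ _*_ (^-distribʳ-* k x y) (^-distribˡ-+-* 2 a b) ⟨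
  (x * y) ^ k * 2 ^ (a + b)                  ≤⟨ *-monoʳ-≤ ((x * y) ^ k) (^-monoʳ-≤ 2 a+b≤) ⟩
  (x * y) ^ k * 2 ^ (2 * k + 2 * c)          ≡⟨ cong ((x * y) ^ k *_) (^-distribˡ-+-* 2 (2 * k) (2 * c)) ⟩
  (x * y) ^ k * (2 ^ (2 * k) * 2 ^ (2 * c))
    ≡⟨ cong₂ (λ p q → (x * y) ^ k * (p * q)) (^-*-assoc 2 2 k) (trans (^-comm 2 c 2) (^-*-assoc 2 2 c)) ⟨
  (x * y) ^ k * (4 ^ k * (2 ^ c) ^ 2)        ≡⟨ *-assoc ((x * y) ^ k) (4 ^ k) ((2 ^ c) ^ 2) ⟨
  (x * y) ^ k * 4 ^ k * (2 ^ c) ^ 2          ≡⟨ cong (_* (2 ^ c) ^ 2) (^-distribʳ-* k (x * y) 4) ⟨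
  (x * y * 4) ^ k * (2 ^ c) ^ 2              ≤⟨ *-monoˡ-≤ ((2 ^ c) ^ 2) (^-monoˡ-≤ k 4xy≤) ⟩
  ((x + y) ^ 2) ^ k * (2 ^ c) ^ 2            ≡⟨ cong (_* (2 ^ c) ^ 2) (^-comm (x + y) 2 k) ⟩
  ((x + y) ^ k) ^ 2 * (2 ^ c) ^ 2            ≡⟨ ^-distribʳ-* 2 ((x + y) ^ k) (2 ^ c) ⟨
  ((x + y) ^ k * 2 ^ c) ^ 2                  ∎)
  where
  open ≤-Reasoning
  eq₁ : ∀ p q r s → (p * q) * (r * s) ≡ (p * r) * (q * s)
  eq₁ = solve-∀
  eq₂ : ∀ x y → x * y * 4 ≡ 2 * (x * y) + 2 * (x * y)
  eq₂ = solve-∀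
  eq₃ : ∀ x y → x * x + y * y + 2 * (x * y) ≡ (x + y) * ((x + y) * 1)
  eq₃ = solve-∀
  4xy≤ : x * y * 4 ≤ (x + y) ^ 2
  4xy≤ = begin
    x * y * 4                    ≡⟨ eq₂ x y ⟩
    2 * (x * y) + 2 * (x * y)    ≤⟨ +-monoˡ-≤ _ (2xy≤x²+y² x y) ⟩
    x * x + y * y + 2 * (x * y)  ≡⟨ eq₃ x y ⟩
    (x + y) ^ 2                  ∎

-- Sums over lists, and permutations

𝟙 : Dec P → ℕ
𝟙 P? = if does P? then 1 else 0

𝟙-mono : (P? : Dec P) (Q? : Dec Q) → (P → Q) → 𝟙 P? ≤ 𝟙 Q?
𝟙-mono (yes p) (yes q) f = ≤-refl
𝟙-mono (yes p) (no ¬q) f = contradiction (f p) ¬q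
𝟙-mono (no ¬p) Q?      f = z≤n

𝟙-yes : (P? : Dec P) → P → 𝟙 P? ≡ 1
𝟙-yes (yes _) p = refl
𝟙-yes (no ¬p) p = contradiction p ¬p

∑-mono : (xs : List A) {f g : A → ℕ} → (∀ {x} → x List.∈ xs → f x ≤ g x) → ∑ xs f ≤ ∑ xs g
∑-mono []       f≤g = z≤n
∑-mono (x ∷ xs) f≤g = +-mono-≤ (f≤g (here refl)) (∑-mono xs (f≤g ∘ there))

∑-cong : (xs : List A) {f g : A → ℕ} → (∀ x → f x ≡ g x) → ∑ xs f ≡ ∑ xs g
∑-cong xs f≗g = cong sum (List.map-cong f≗g xs)

∑-const : (xs : List A) (c : ℕ) → ∑ xs (λ _ → c) ≡ length xs * c
∑-const []       c = refl
∑-const (x ∷ xs) c = cong (c +_) (∑-const xs c)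

∑-*ˡ : (xs : List A) (c : ℕ) (f : A → ℕ) → ∑ xs (λ x → c * f x) ≡ c * ∑ xs f
∑-*ˡ []       c f = sym (*-zeroʳ c)
∑-*ˡ (x ∷ xs) c f = trans (cong (c * f x +_) (∑-*ˡ xs c f)) (sym (*-distribˡ-+ c (f x) (∑ xs f)))

∑-*ʳ : (xs : List A) (c : ℕ) (f : A → ℕ) → ∑ xs (λ x → f x * c) ≡ ∑ xs f * c
∑-*ʳ xs c f = trans (∑-cong xs (λ x → *-comm (f x) c)) (trans (∑-*ˡ xs c f) (*-comm c (∑ xs f)))

∑-+ : (xs : List A) (f g : A → ℕ) → ∑ xs (λ x → f x + g x) ≡ ∑ xs f + ∑ xs g
∑-+ []       f g = refl
∑-+ (x ∷ xs) f g = trans (cong (f x + g x +_) (∑-+ xs f g)) (interchange (f x) (g x) (∑ xs f) (∑ xs g))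

∑-swap : (xs : List A) (ys : List B) (f : A → B → ℕ) →
         ∑ xs (λ x → ∑ ys (f x)) ≡ ∑ ys (λ y → ∑ xs (λ x → f x y))
∑-swap []       ys f = sym (trans (∑-const ys 0) (*-zeroʳ (length ys)))
∑-swap (x ∷ xs) ys f = trans (cong (∑ ys (f x) +_) (∑-swap xs ys f)) (sym (∑-+ ys (f x) _))

∑-map : (g : A → B) (xs : List A) (f : B → ℕ) → ∑ (map g xs) f ≡ ∑ xs (f ∘ g)
∑-map g xs f = cong sum (sym (List.map-∘ xs))

∑-↭ : {xs ys : List A} (f : A → ℕ) → xs ↭ ys → ∑ xs f ≡ ∑ ys f
∑-↭ f xs↭ys = sum-↭ (↭.map⁺ f xs↭ys)

∑-++ : (xs ys : List A) (f : A → ℕ) → ∑ (xs ++ ys) f ≡ ∑ xs f + ∑ ys f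
∑-++ xs ys f = trans (cong sum (List.map-++ f xs ys)) (sum-++ (map f xs) (map f ys))

∑-cartesianProductWith : (g : A → B → C) (xs : List A) (ys : List B) (f : C → ℕ) →
                         ∑ (cartesianProductWith g xs ys) f ≡ ∑ xs (λ x → ∑ ys (λ y → f (g x y)))
∑-cartesianProductWith g []       ys f = refl
∑-cartesianProductWith g (x ∷ xs) ys f =
  trans (∑-++ (map (g x) ys) _ f) (cong₂ _+_ (∑-map (g x) ys f) (∑-cartesianProductWith g xs ys f))

length-filter-∑ : {P : Pred A 0ℓ} (P? : Decidable P) (xs : List A) → length (filter P? xs) ≡ ∑ xs (𝟙 ∘ P?)
length-filter-∑ P? []       = refl
length-filter-∑ P? (x ∷ xs) with does (P? x)
... | true  = cong suc (length-filter-∑ P? xs)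
... | false = length-filter-∑ P? xs

∑-filter-¬ : {P : Pred A 0ℓ} (P? : Decidable P) (xs : List A) (f : A → ℕ) →
             ∑ (filter P? xs) f + ∑ (filter (¬? ∘ P?) xs) f ≡ ∑ xs f
∑-filter-¬ P? []       f = refl
∑-filter-¬ P? (x ∷ xs) f with does (P? x)
... | true  = trans (+-assoc (f x) (∑ (filter P? xs) f) _) (cong (f x +_) (∑-filter-¬ P? xs f))
... | false = trans (x∙yz≈y∙xz (∑ (filter P? xs) f) (f x) _) (cong (f x +_) (∑-filter-¬ P? xs f))

∑-∈ : {x : A} {xs : List A} (f : A → ℕ) → x List.∈ xs → f x ≤ ∑ xs f
∑-∈ f (here refl)  = m≤m+n _ _
∑-∈ f (there x∈xs) = ≤-trans (∑-∈ f x∈xs) (m≤n+m _ _)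

∑-𝟙-unique : {xs : List A} {P : A → Set} (P? : ∀ x → Dec (P x)) → List.Unique xs →
             (∀ {x y} → P x → P y → x ≡ y) → ∑ xs (𝟙 ∘ P?) ≤ 1
∑-𝟙-unique {xs = []} P? []        P-unique = z≤n
∑-𝟙-unique {xs = x ∷ xs} P? (x∉xs ∷ xs!) P-unique with P? x
... | no  _  = ∑-𝟙-unique P? xs! P-unique
... | yes Px = s≤s (≤-trans (∑-mono xs λ {y} y∈xs → 𝟙≤0 (P? y) λ Py → All.lookup x∉xs y∈xs (P-unique Px Py))
                            (≤-reflexive (trans (∑-const xs 0) (*-zeroʳ (length xs)))))
  where
  𝟙≤0 : (Q? : Dec Q) → ¬ Q → 𝟙 Q? ≤ 0
  𝟙≤0 (yes q) ¬q = contradiction q ¬q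
  𝟙≤0 (no _)  ¬q = z≤n

∣p∣≡∑𝟙 : (s : Subset n) → ∣ s ∣ ≡ ∑ (allFin n) (λ i → 𝟙 (i ∈? s))
∣p∣≡∑𝟙 {n} s = trans (go s) (cong sum (sym (List.map-tabulate {n = n} id (λ i → 𝟙 (i ∈? s)))))
  where
  go : (s : Subset m) → ∣ s ∣ ≡ sum (tabulateᴸ (λ i → 𝟙 (i ∈? s)))
  go []            = refl
  go (inside ∷ s)  = cong suc (go s)
  go (outside ∷ s) = go s

-- Enumeration of assignments and permutations

allVecs-unique : {xs : List A} → List.Unique xs → ∀ n → List.Unique (allVecs xs n)
allVecs-unique xs! zero    = [] ∷ []
allVecs-unique xs! (suc n) =
  UniqueList.cartesianProductWith⁺ _∷_ Vec.∷-injective xs! (allVecs-unique xs! n)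

∈-allVecs : {xs : List A} → (∀ x → x List.∈ xs) → (v : Vec A n) → v List.∈ allVecs xs n
∈-allVecs ∈xs []      = here refl
∈-allVecs ∈xs (x ∷ v) = List.∈-cartesianProductWith⁺ _∷_ (∈xs x) (∈-allVecs ∈xs v)

∈-allAssignments : (z : Assignment n) → z List.∈ allAssignments n
∈-allAssignments = ∈-allVecs λ { false → here refl ; true → there (here refl) }

allAssignments-unique : ∀ n → List.Unique (allAssignments n)
allAssignments-unique = allVecs-unique (((λ ()) ∷ []) ∷ ([] ∷ []))

∈-allPermutations⁺ : {π : Vec (Fin n) n} → Unique π → π List.∈ allPermutations n
∈-allPermutations⁺ = List.∈-filter⁺ (allPairs? _) (∈-allVecs List.∈-allFin _)

∈-allPermutations⁻ : {π : Vec (Fin n) n} → π List.∈ allPermutations n → Unique π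
∈-allPermutations⁻ {n} = proj₂ ∘ List.∈-filter⁻ (allPairs? _) {xs = allVecs (allFin n) n}

allPermutations-nonEmpty : ∀ n → NonZero (length (allPermutations n))
allPermutations-nonEmpty n = >-nonZero (List.∈-length (∈-allPermutations⁺ (UniqueVec.tabulate⁺ {n = n} id)))

-- Pigeonhole: if `i` were missed, punching it out of the values would inject `Fin (suc n)` into
-- `Fin n`.
permutation-surjective : {π : Vec (Fin n) n} → Unique π → ∀ i → i VecM.∈ π
permutation-surjective {suc n} {π} π! i with Fin.any? (λ j → i Fin.≟ lookup π j)
... | yes (j , i≡πj) = subst (VecM._∈ π) (sym i≡πj) (VecM.∈-lookup j π)
... | no  i∉π        = contradiction (λ {x} {y} eq → UniqueVec.lookup-injective π! x y (Fin.punchOut-injective (i∉π ∘ (x ,_)) (i∉π ∘ (y ,_)) eq))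
                                     (Fin.<⇒notInjective {f = λ j → punchOut (i∉π ∘ (j ,_))} (n<1+n n))

module _ (f g : Fin n → Fin n) (fg : ∀ i → f (g i) ≡ i) (gf : ∀ i → g (f i) ≡ i) where
  -- Both lists are duplicate-free, and relabelling values by a bijection preserves membership in
  -- either direction.
  map-allPermutations : map (Vec.map f) (allPermutations n) ↭ allPermutations n
  map-allPermutations = ∼bag⇒↭ (unique∧set⇒bag
    (UniqueList.map⁺ (λ {u} {v} eq → trans (sym (map-inverse {f = f} {g} gf u)) (trans (cong (Vec.map g) eq) (map-inverse {f = f} {g} gf v))) !perms)
    !perms
    (mk⇔ to from))
    where
    !perms : List.Unique (allPermutations n)
    !perms = UniqueList.filter⁺ (allPairs? _) (allVecs-unique (UniqueList.allFin⁺ n) n)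
    map-inverse : {f g : Fin n → Fin n} → (∀ i → g (f i) ≡ i) → (v : Vec (Fin n) m) → Vec.map g (Vec.map f v) ≡ v
    map-inverse {f = f} {g} gf v = trans (sym (Vec.map-∘ g f v)) (trans (Vec.map-cong gf v) (Vec.map-id v))
    injective : {f g : Fin n → Fin n} → (∀ i → g (f i) ≡ i) → ∀ {x y} → f x ≡ f y → x ≡ y
    injective {g = g} gf {x} {y} eq = trans (sym (gf x)) (trans (cong g eq) (gf y))
    to : ∀ {v} → v List.∈ map (Vec.map f) (allPermutations n) → v List.∈ allPermutations n
    to v∈ with u , u∈ , refl ← List.∈-map⁻ (Vec.map f) v∈ =
      ∈-allPermutations⁺ (UniqueVec.map⁺ (injective {f = f} {g} gf) (∈-allPermutations⁻ u∈))
    from : ∀ {v} → v List.∈ allPermutations n → v List.∈ map (Vec.map f) (allPermutations n)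
    from {v} v∈ = subst (List._∈ _) (map-inverse {f = g} {f} fg v)
      (List.∈-map⁺ (Vec.map f) (∈-allPermutations⁺ (UniqueVec.map⁺ (injective {f = g} {f} fg) (∈-allPermutations⁻ v∈))))

-- The last element of a set in a random permutation

data Last (V : Subset n) (i : Fin n) : Vec (Fin n) m → Set where
  here  : {π : Vec (Fin n) m} → i ∈ V → VecAll.All (_∉ V) π → Last V i (i ∷ π)
  there : ∀ {h} {π : Vec (Fin n) m} → Last V i π → Last V i (h ∷ π)

last? : (V : Subset n) (i : Fin n) (π : Vec (Fin n) m) → Dec (Last V i π)
last? V i []      = no λ ()
last? V i (h ∷ π) with last? V i π
... | yes l = yes (there l)
... | no ¬l with i Fin.≟ h
...   | no i≢h = no λ { (here _ _) → i≢h refl ; (there l) → ¬l l }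
...   | yes refl = map′ (λ (x , y) → here x y) (λ { (here x y) → x , y ; (there l) → contradiction l ¬l })
                        (i ∈? V ×-dec VecAll.all? (¬? ∘ (_∈? V)) π)

∃-last : (V : Subset n) (π : Vec (Fin n) m) → ∃ (λ j → j ∈ V × Last V j π) ⊎ VecAll.All (_∉ V) π
∃-last V [] = inj₂ VecAll.[]
∃-last V (h ∷ π) with ∃-last V π
... | inj₁ (j , j∈V , l) = inj₁ (j , j∈V , there l)
... | inj₂ π∉V with h ∈? V
...   | yes h∈V = inj₁ (h , h∈V , here h∈V π∉V)
...   | no  h∉V = inj₂ (h∉V VecAll.∷ π∉V)

map-last : {V : Subset n} {f : Fin n → Fin n} → (∀ {i} → i ∈ V → f i ∈ V) → (∀ {i} → i ∉ V → f i ∉ V) →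
           ∀ {i} {π : Vec (Fin n) m} → Last V i π → Last V (f i) (Vec.map f π)
map-last f∈ f∉ (here i∈V π∉V) = here (f∈ i∈V) (VecAll.map⁺ (VecAll.map f∉ π∉V))
map-last f∈ f∉ (there l)      = there (map-last f∈ f∉ l)

transpose-eval : (i j : Fin n) → transpose i j j ≡ i
transpose-eval i j with j Fin.≟ i
... | yes j≡i = j≡i
... | no  _ with j Fin.≟ j
...   | yes _  = refl
...   | no j≢j = contradiction refl j≢j

transpose-∈ : {V : Subset n} {i j : Fin n} → i ∈ V → j ∈ V → ∀ {l} → l ∈ V → transpose i j l ∈ V
transpose-∈ {i = i} {j} i∈V j∈V {l} l∈V with l Fin.≟ i
... | yes _ = j∈V
... | no  _ with l Fin.≟ j
...   | yes _ = i∈V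
...   | no  _ = l∈V

#last : Subset n → Fin n → ℕ
#last {n} V i = ∑ (allPermutations n) (λ π → 𝟙 (last? V i π))

-- By symmetry: exchanging the values `i` and `j` maps `V` to itself, so it carries permutations in
-- which `j` comes last to permutations in which `i` does.
#last-≤ : {V : Subset n} {i j : Fin n} → i ∈ V → j ∈ V → #last V j ≤ #last V i
#last-≤ {n} {V} {i} {j} i∈V j∈V = begin
  ∑ perms (λ π → 𝟙 (last? V j π))
    ≤⟨ ∑-mono perms (λ {π} _ → 𝟙-mono (last? V j π) (last? V i (Vec.map τ π)) τ-last) ⟩
  ∑ perms (λ π → 𝟙 (last? V i (Vec.map τ π)))        ≡⟨ ∑-map (Vec.map τ) perms (λ π → 𝟙 (last? V i π)) ⟨
  ∑ (map (Vec.map τ) perms) (λ π → 𝟙 (last? V i π))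
    ≡⟨ ∑-↭ (λ π → 𝟙 (last? V i π)) (map-allPermutations τ τ′ (λ _ → transpose-inverse i j) (λ _ → transpose-inverse j i)) ⟩
  ∑ perms (λ π → 𝟙 (last? V i π))                    ∎
  where
  open ≤-Reasoning
  perms = allPermutations n
  τ  = transpose i j
  τ′ = transpose j i
  τ-last : {π : Vec (Fin n) n} → Last V j π → Last V i (Vec.map τ π)
  τ-last {π} l = subst (λ x → Last V x (Vec.map τ π)) (transpose-eval i j)
    (map-last (transpose-∈ i∈V j∈V)
              (λ k∉V τk∈V → k∉V (subst (_∈ V) (transpose-inverse j i) (transpose-∈ j∈V i∈V τk∈V))) l)

-- Some element of `V` comes last in every permutation, and all elements are equally likely to, so
-- `i` does with probability at least `1 / ∣ V ∣`.
#last-≥ : {V : Subset n} {i : Fin n} → i ∈ V → length (allPermutations n) ≤ ∣ V ∣ * #last V i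
#last-≥ {n} {V} {i} i∈V = begin
  length perms                                 ≡⟨ trans (∑-const perms 1) (*-identityʳ _) ⟨
  ∑ perms (λ _ → 1)                            ≤⟨ ∑-mono perms one ⟩
  ∑ perms (λ π → ∑ (allFin n) (λ j → 𝟙 (j ∈? V) * 𝟙 (last? V j π))) ≡⟨ ∑-swap perms (allFin n) _ ⟩
  ∑ (allFin n) (λ j → ∑ perms (λ π → 𝟙 (j ∈? V) * 𝟙 (last? V j π)))
    ≡⟨ ∑-cong (allFin n) (λ j → ∑-*ˡ perms (𝟙 (j ∈? V)) _) ⟩
  ∑ (allFin n) (λ j → 𝟙 (j ∈? V) * #last V j)  ≤⟨ ∑-mono (allFin n) (λ {j} _ → bound j) ⟩
  ∑ (allFin n) (λ j → 𝟙 (j ∈? V) * #last V i)  ≡⟨ ∑-*ʳ (allFin n) (#last V i) _ ⟩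
  ∑ (allFin n) (λ j → 𝟙 (j ∈? V)) * #last V i  ≡⟨ cong (_* #last V i) (∣p∣≡∑𝟙 V) ⟨
  ∣ V ∣ * #last V i                            ∎
  where
  open ≤-Reasoning
  perms = allPermutations n
  one : ∀ {π} → π List.∈ perms → 1 ≤ ∑ (allFin n) (λ j → 𝟙 (j ∈? V) * 𝟙 (last? V j π))
  one {π} π∈ with ∃-last V π
  ... | inj₂ π∉V = contradiction i∈V (VecAll.lookup π∉V (permutation-surjective (∈-allPermutations⁻ π∈) i))
  ... | inj₁ (j , j∈V , l) = ≤-trans
    (≤-reflexive (sym (cong₂ _*_ (𝟙-yes (j ∈? V) j∈V) (𝟙-yes (last? V j π) l))))
    (∑-∈ (λ j → 𝟙 (j ∈? V) * 𝟙 (last? V j π)) (List.∈-allFin j))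
  bound : ∀ j → 𝟙 (j ∈? V) * #last V j ≤ 𝟙 (j ∈? V) * #last V i
  bound j with j ∈? V
  ... | yes j∈V = *-monoʳ-≤ 1 (#last-≤ i∈V j∈V)
  ... | no  _   = z≤n

-- The coordinates in `s` are free while the others are copied from `z`; the count splits on the
-- first coordinate.
2^∣p∣≤∑𝟙 : (s : Subset n) (z : Assignment n) {P : Assignment n → Set} (P? : ∀ y → Dec (P y)) →
          (∀ y → (∀ i → i ∉ s → lookup y i ≡ lookup z i) → P y) →
          2 ^ ∣ s ∣ ≤ ∑ (allAssignments n) (𝟙 ∘ P?)
2^∣p∣≤∑𝟙 {n = zero} [] [] P? agree⇒P = ≤-reflexive (sym (cong (_+ 0) (𝟙-yes (P? []) (agree⇒P [] λ ()))))
2^∣p∣≤∑𝟙 {n = suc n} (s ∷ ss) (z ∷ zs) {P} P? agree⇒P =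
  subst (2 ^ ∣ s ∷ ss ∣ ≤_) (sym (∑-cartesianProductWith _∷_ (false ∷ true ∷ []) (allAssignments n) (𝟙 ∘ P?)))
    (bound s z agree⇒P)
  where
  half : Bool → ℕ
  half b = ∑ (allAssignments n) (λ y → 𝟙 (P? (b ∷ y)))
  Agree⇒P : Bool → Bool → Set
  Agree⇒P s z = ∀ y → (∀ i → i ∉ (s ∷ ss) → lookup y i ≡ lookup (z ∷ zs) i) → P y
  inside-half : ∀ z → Agree⇒P inside z → ∀ b → 2 ^ ∣ ss ∣ ≤ half b
  inside-half z agree⇒P b = 2^∣p∣≤∑𝟙 ss zs (λ y → P? (b ∷ y)) λ y agree → agree⇒P (b ∷ y) λ where
    zero    z∉  → contradiction Vec.here z∉
    (suc i) si∉ → agree i (si∉ ∘ Vec.there)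
  outside-half : ∀ z → Agree⇒P outside z → 2 ^ ∣ ss ∣ ≤ half z
  outside-half z agree⇒P = 2^∣p∣≤∑𝟙 ss zs (λ y → P? (z ∷ y)) λ y agree → agree⇒P (z ∷ y) λ where
    zero    _   → refl
    (suc i) si∉ → agree i (si∉ ∘ Vec.there)
  bound : ∀ s z → Agree⇒P s z → 2 ^ ∣ s ∷ ss ∣ ≤ half false + (half true + 0)
  bound inside  z     h = +-mono-≤ (inside-half z h false) (+-monoˡ-≤ 0 (inside-half z h true))
  bound outside false h = ≤-trans (outside-half false h) (m≤m+n _ _)
  bound outside true  h = ≤-trans (outside-half true h) (≤-trans (m≤m+n _ 0) (m≤n+m _ (half false)))

-- Correctness of PPZ on forced variables

x∉p-x : (p : Subset n) (x : Fin n) → x ∉ p - x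
x∉p-x (_ ∷ p) zero    ()
x∉p-x (_ ∷ p) (suc x) (there x∈) = x∉p-x p x x∈

last⇒∈ : {V : Subset n} {i : Fin n} {π : Vec (Fin n) m} → Last V i π → i VecM.∈ π
last⇒∈ (here _ _) = VecAny.here refl
last⇒∈ (there l)  = VecAny.there (last⇒∈ l)

last-antitone : {U V : Subset n} {i : Fin n} {π : Vec (Fin n) m} →
                (∀ {j} → j ∈ U → j ∈ V) → i ∈ U → Last V i π → Last U i π
last-antitone U⊆V i∈U (here _ π∉V) = here i∈U (VecAll.map (_∘ U⊆V) π∉V)
last-antitone U⊆V i∈U (there l)    = there (last-antitone U⊆V i∈U l)

vars : Clause n → Subset n
vars C = pos C ∪ neg C

lits⊆vars : ∀ b {C : Clause n} {i} → i ∈ lits b C → i ∈ vars C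
lits⊆vars true  {C} = p⊆p∪q (neg C)
lits⊆vars false {C} = q⊆p∪q (pos C) (neg C)

vars⊆lits : {C : Clause n} {i : Fin n} → i ∈ vars C → ∃ λ b → i ∈ lits b C
vars⊆lits {C = C} i∈ with x∈p∪q⁻ (pos C) (neg C) i∈
... | inj₁ i∈pos = true , i∈pos
... | inj₂ i∈neg = false , i∈neg

∈-deleteFalse⁺ : ∀ {h} b c {C : Clause n} {i} → i ≢ h → i ∈ lits c C → i ∈ lits c (deleteFalse h b C)
∈-deleteFalse⁺ true  true  i≢h i∈ = i∈
∈-deleteFalse⁺ true  false i≢h i∈ = x∈p∧x≢y⇒x∈p-y i∈ i≢h
∈-deleteFalse⁺ false true  i≢h i∈ = x∈p∧x≢y⇒x∈p-y i∈ i≢h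
∈-deleteFalse⁺ false false i≢h i∈ = i∈

∈-deleteFalse⁻ : ∀ h b c {C : Clause n} {i} → i ∈ lits c (deleteFalse h b C) → i ∈ lits c C
∈-deleteFalse⁻ h true  true      i∈ = i∈
∈-deleteFalse⁻ h true  false {C} i∈ = p─q⊆p (neg C) ⁅ h ⁆ i∈
∈-deleteFalse⁻ h false true  {C} i∈ = p─q⊆p (pos C) ⁅ h ⁆ i∈
∈-deleteFalse⁻ h false false     i∈ = i∈

∉-deleteFalse : ∀ h b {C : Clause n} → h ∉ lits (not b) (deleteFalse h b C)
∉-deleteFalse h true  {C} = x∉p-x (neg C) h
∉-deleteFalse h false {C} = x∉p-x (pos C) h

⊨ᶜ-unit : ∀ b {i} {z : Assignment n} → z ⊨ᶜ unit b i → lookup z i ≡ b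
⊨ᶜ-unit true  {i} {z} (j , j∈) with lookup z j in eq
... | true  = trans (cong (lookup z) (sym (x∈⁅y⁆⇒x≡y i j∈))) eq
... | false = contradiction j∈ ∉⊥
⊨ᶜ-unit false {i} {z} (j , j∈) with lookup z j in eq
... | true  = contradiction j∈ ∉⊥
... | false = trans (cong (lookup z) (sym (x∈⁅y⁆⇒x≡y i j∈))) eq

-- A unit clause of `F` is satisfied by `z`, so it can only prescribe the value of `z`. The base
-- value is consulted only when neither unit clause is present, which excludes the second
-- alternative.
choose-correct : (F : CNF n) (i : Fin n) {y : Bool} (z : Assignment n) → z ⊨ F →
                 y ≡ lookup z i ⊎ unit (lookup z i) i List.∈ F → choose F i y ≡ lookup z i
choose-correct F i {y} z z⊨F y≡z⊎unit
  with unit true i ∈CNF? F | unit false i ∈CNF? F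
  where open DecMembership _≟ᶜ_ renaming (_∈?_ to _∈CNF?_)
... | yes ∈F | _      = sym (⊨ᶜ-unit true {z = z} (All.lookup z⊨F ∈F))
... | no  _  | yes ∈F = sym (⊨ᶜ-unit false {z = z} (All.lookup z⊨F ∈F))
... | no ∉F₁ | no ∉F₀ with lookup z i | y≡z⊎unit
...   | _     | inj₁ y≡z = y≡z
...   | true  | inj₂ ∈F  = contradiction ∈F ∉F₁
...   | false | inj₂ ∈F  = contradiction ∈F ∉F₀

-- `C` is satisfied by `z` through variable `i` only. The field `unnegated` excludes clauses
-- containing both literals of `i`: these survive flipping `i`, and fixing other variables never
-- turns them into a unit clause.
record Critical (z : Assignment n) (i : Fin n) (C : Clause n) : Set where
  field
    literal : i ∈ lits (lookup z i) C
    only    : ∀ {j} → j ∈ lits (lookup z j) C → j ≡ i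
    unnegated : i ∉ lits (not (lookup z i)) C

open Critical

-- The invariant of a run: `C` is a clause as restricted so far and `π` lists the variables still to
-- come, to which `scope` confines the variables of `C`.
record Forcing (z : Assignment n) (i : Fin n) (π : Vec (Fin n) m) (C : Clause n) : Set where
  field
    critical : Critical z i C
    scope    : ∀ {j} → j ∈ vars C → j VecM.∈ π
    last     : Last (vars C) i π

open Forcing

Bool-cases : ∀ b c → c ≡ b ⊎ c ≡ not b
Bool-cases true  true  = inj₁ refl
Bool-cases true  false = inj₂ refl
Bool-cases false true  = inj₂ refl
Bool-cases false false = inj₁ refl

≡-unit : ∀ b {i} {C : Clause n} → i ∈ lits b C → i ∉ lits (not b) C → (∀ {j} → j ∈ vars C → j ≡ i) →
         C ≡ unit b i
≡-unit b {i} {C} i∈ i∉ vars⊆i = go b i∈ i∉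
  where
  singleton : ∀ b → i ∈ lits b C → lits b C ≡ ⁅ i ⁆
  singleton b i∈ = ⊆-antisym (λ j∈ → subst (_∈ ⁅ i ⁆) (sym (vars⊆i (lits⊆vars b j∈))) (x∈⁅x⁆ i))
                             (λ j∈ → subst (_∈ lits b C) (sym (x∈⁅y⁆⇒x≡y i j∈)) i∈)
  empty : ∀ b → i ∉ lits b C → lits b C ≡ ⊥
  empty b i∉ = Empty-unique λ (j , j∈) → i∉ (subst (_∈ lits b C) (vars⊆i (lits⊆vars b j∈)) j∈)
  go : ∀ b → i ∈ lits b C → i ∉ lits (not b) C → C ≡ unit b i
  go true  i∈ i∉ = cong₂ clause (singleton true i∈) (empty false i∉)
  go false i∈ i∉ = cong₂ clause (empty true i∉) (singleton false i∈)

-- By `scope` any other variable of `C` would stand in `π`, but none of `C` follows its last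
-- variable `i`; only the true literal of `i` is left.
forcing-head : {z : Assignment n} {i : Fin n} {π : Vec (Fin n) m} {C : Clause n} →
               Unique (i ∷ π) → Forcing z i (i ∷ π) C → C ≡ unit (lookup z i) i
forcing-head {z = z} {i} {π} (i∉π ∷ _) f with last f
... | there l     = contradiction refl (VecAll.lookup i∉π (last⇒∈ l))
... | here _ π∉V = ≡-unit _ (literal (critical f)) (unnegated (critical f)) (λ j∈ → only-i j∈ (scope f j∈))
  where
  only-i : ∀ {j} → j ∈ vars _ → j VecM.∈ (i ∷ π) → j ≡ i
  only-i j∈ (VecAny.here j≡i)  = j≡i
  only-i j∈ (VecAny.there j∈π) = contradiction j∈ (VecAll.lookup π∉V j∈π)

-- Variable `h` disappears from `C`: its false literal is deleted, and its true literal cannot occur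
-- because that of `i` is the only true one.
forcing-tail : {z : Assignment n} {h i : Fin n} {π : Vec (Fin n) m} {C : Clause n} →
               i ≢ h → Forcing z i (h ∷ π) C → Forcing z i π (deleteFalse h (lookup z h) C)
forcing-tail {n = n} {z = z} {h} {i} {π} {C} i≢h f = record
  { critical = record
    { literal = i∈C′
    ; only = λ {j} j∈ → only (critical f) (∈-deleteFalse⁻ h b (lookup z j) {C} j∈)
    ; unnegated = λ i∈ → unnegated (critical f) (∈-deleteFalse⁻ h b (not (lookup z i)) {C} i∈)
    }
  ; scope = λ {j} j∈ → scope-tail j∈ (scope f (vars-⊆ j∈))
  ; last  = last-tail (last f)
  }
  where
  b = lookup z h
  C′ = deleteFalse h b C
  i∈C′ = ∈-deleteFalse⁺ b (lookup z i) {C} i≢h (literal (critical f))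
  vars-⊆ : ∀ {j} → j ∈ vars C′ → j ∈ vars C
  vars-⊆ j∈ with c , j∈c ← vars⊆lits {C = C′} j∈ = lits⊆vars c (∈-deleteFalse⁻ h b c {C} j∈c)
  h∉ : ∀ c → h ∉ lits c C′
  h∉ c h∈ with Bool-cases b c
  ... | inj₁ refl = i≢h (sym (only (critical f) (∈-deleteFalse⁻ h b c {C} h∈)))
  ... | inj₂ refl = ∉-deleteFalse h b {C} h∈
  scope-tail : ∀ {j} → j ∈ vars C′ → j VecM.∈ (h ∷ π) → j VecM.∈ π
  scope-tail j∈ (VecAny.there j∈π) = j∈π
  scope-tail j∈ (VecAny.here refl) with c , h∈ ← vars⊆lits {C = C′} j∈ = contradiction h∈ (h∉ c)
  last-tail : Last (vars C) i (h ∷ π) → Last (vars C′) i π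
  last-tail (here _ _) = contradiction refl i≢h
  last-tail (there l)  = last-antitone vars-⊆ (lits⊆vars (lookup z i) i∈C′) l

⊨-restrict : (F : CNF n) (h : Fin n) (z : Assignment n) → z ⊨ F → z ⊨ F [ h := lookup z h ]
⊨-restrict F h z z⊨F = All.map⁺ (All.tabulate satisfied)
  where
  satisfied : ∀ {C} → C List.∈ filter (λ C → ¬? (h ∈? lits (lookup z h) C)) F → z ⊨ᶜ deleteFalse h (lookup z h) C
  satisfied {C} C∈ with C∈F , h∉ ← List.∈-filter⁻ _ {xs = F} C∈ with j , j∈ ← All.lookup z⊨F C∈F =
    j , ∈-deleteFalse⁺ (lookup z h) (lookup z j) {C} (λ { refl → h∉ j∈ }) j∈

-- Induction along `π`. The head receives its value under `z`, either from `y` or from a forcing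
-- clause that has become a unit clause; hence the restriction is made according to `z`, and the
-- hypotheses pass to the tail.
ppz-correct : (F : CNF n) (z : Assignment n) (y : Assignment n) (π : Vec (Fin n) m) → z ⊨ F → Unique π →
              (∀ {i} → i VecM.∈ π → lookup y i ≡ lookup z i ⊎ ∃ λ C → C List.∈ F × Forcing z i π C) →
              ∀ {i} → i VecM.∈ π → lookup (ppz F y π) i ≡ lookup z i
ppz-correct {n} F z y (h ∷ π) z⊨F π!@(h∉π ∷ π!′) hyp {i} i∈
  with choose F h (lookup y h) | choose-correct F h z z⊨F head
  where
  head : lookup y h ≡ lookup z h ⊎ unit (lookup z h) h List.∈ F
  head with hyp (VecAny.here refl)
  ... | inj₁ y≡z            = inj₁ y≡z
  ... | inj₂ (C , C∈F , f) = inj₂ (subst (List._∈ F) (forcing-head π! f) C∈F)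
... | _ | refl with i Fin.≟ h | i∈
...   | yes refl | _               = Vec.lookup∘update h (ppz (F [ h := lookup z h ]) y π) _
...   | no  i≢h  | VecAny.here i≡h = contradiction i≡h i≢h
...   | no  i≢h  | VecAny.there i∈π =
  trans (Vec.lookup∘update′ i≢h (ppz (F [ h := lookup z h ]) y π) _)
        (ppz-correct (F [ h := lookup z h ]) z y π (⊨-restrict F h z z⊨F) π!′ tail i∈π)
  where
  tail : ∀ {j} → j VecM.∈ π → lookup y j ≡ lookup z j ⊎ ∃ λ C → C List.∈ F [ h := lookup z h ] × Forcing z j π C
  tail {j} j∈π with hyp (VecAny.there j∈π)
  ... | inj₁ y≡z           = inj₁ y≡z
  ... | inj₂ (C , C∈F , f) = inj₂ (_ , List.∈-map⁺ _ (List.∈-filter⁺ _ C∈F h∉C) , forcing-tail j≢h f)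
    where
    j≢h : j ≢ h
    j≢h refl = contradiction refl (VecAll.lookup h∉π j∈π)
    -- The clause forcing `j` is not removed as satisfied when `h` is set, since its only true
    -- literal belongs to `j`.
    h∉C : h ∉ lits (lookup z h) C
    h∉C h∈ = j≢h (sym (only (critical f) h∈))

-- The probability of a fixed satisfying assignment

∣p∪q∣≤∣p∣+∣q∣ : (p q : Subset n) → ∣ p ∪ q ∣ ≤ ∣ p ∣ + ∣ q ∣
∣p∪q∣≤∣p∣+∣q∣ []            []            = z≤n
∣p∪q∣≤∣p∣+∣q∣ (outside ∷ p) (outside ∷ q) = ∣p∪q∣≤∣p∣+∣q∣ p q
∣p∪q∣≤∣p∣+∣q∣ (outside ∷ p) (inside ∷ q)  = ≤-trans (s≤s (∣p∪q∣≤∣p∣+∣q∣ p q)) (≤-reflexive (sym (+-suc ∣ p ∣ ∣ q ∣)))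
∣p∪q∣≤∣p∣+∣q∣ (inside ∷ p)  (outside ∷ q) = s≤s (∣p∪q∣≤∣p∣+∣q∣ p q)
∣p∪q∣≤∣p∣+∣q∣ (inside ∷ p)  (inside ∷ q)  = s≤s (≤-trans (∣p∪q∣≤∣p∣+∣q∣ p q) (+-monoʳ-≤ ∣ p ∣ (n≤1+n ∣ q ∣)))

toSubset : {P : Fin n → Set} → (∀ i → Dec (P i)) → Subset n
toSubset P? = tabulate (does ∘ P?)

module _ {P : Fin n → Set} (P? : ∀ i → Dec (P i)) where
  ∈-toSubset⁺ : ∀ {i} → P i → i ∈ toSubset P?
  ∈-toSubset⁺ {i} Pi = Vec.lookup⇒[]= i _ (trans (Vec.lookup∘tabulate _ i) (dec-true (P? i) Pi))

  ∈-toSubset⁻ : ∀ {i} → i ∈ toSubset P? → P i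
  ∈-toSubset⁻ {i} i∈ with P? i in eq
  ... | yes Pi = Pi
  ... | no  _  with () ← trans (sym (Vec.[]=⇒lookup i∈)) (trans (Vec.lookup∘tabulate _ i) (cong does eq))

_≟ᵃ_ : DecidableEquality (Assignment n)
_≟ᵃ_ = Vec.≡-dec Bool._≟_

module _ {n : ℕ} where
  open DecMembership (_≟ᵃ_ {n}) public using () renaming (_∈?_ to _∈ᴸ?_)

flip : Vec Bool n → Fin n → Vec Bool n
flip z i = updateAt z i not

lookup-flip : (z : Vec Bool n) (i : Fin n) → lookup (flip z i) i ≡ not (lookup z i)
lookup-flip z i = Vec.lookup∘updateAt i z

lookup-flip-≢ : (z : Vec Bool n) {i j : Fin n} → j ≢ i → lookup (flip z i) j ≡ lookup z j
lookup-flip-≢ z {i} {j} j≢i = Vec.lookup∘updateAt′ j i j≢i z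

∣flip∣-∈ : {p : Subset n} {i : Fin n} → i ∈ p → suc ∣ flip p i ∣ ≡ ∣ p ∣
∣flip∣-∈                   here       = refl
∣flip∣-∈ {p = inside ∷ _}  (there i∈) = cong suc (∣flip∣-∈ i∈)
∣flip∣-∈ {p = outside ∷ _} (there i∈) = ∣flip∣-∈ i∈

∣flip∣-∉ : {p : Subset n} {i : Fin n} → i ∉ p → ∣ flip p i ∣ ≡ suc ∣ p ∣
∣flip∣-∉ {p = inside ∷ _}  {zero}  i∉ = contradiction here i∉
∣flip∣-∉ {p = outside ∷ _} {zero}  i∉ = refl
∣flip∣-∉ {p = inside ∷ _}  {suc i} i∉ = cong suc (∣flip∣-∉ (i∉ ∘ there))
∣flip∣-∉ {p = outside ∷ _} {suc i} i∉ = ∣flip∣-∉ (i∉ ∘ there)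

nbrs : List (Assignment n) → Assignment n → Subset n
nbrs L z = toSubset (λ i → flip z i ∈ᴸ? L)

∈-nbrs⁺ : (L : List (Assignment n)) (z : Assignment n) {i : Fin n} → flip z i List.∈ L → i ∈ nbrs L z
∈-nbrs⁺ L z = ∈-toSubset⁺ (λ i → flip z i ∈ᴸ? L)

∈-nbrs⁻ : (L : List (Assignment n)) (z : Assignment n) {i : Fin n} → i ∈ nbrs L z → flip z i List.∈ L
∈-nbrs⁻ L z = ∈-toSubset⁻ (λ i → flip z i ∈ᴸ? L)

∈-Ω⁺ : {F : CNF n} {z : Assignment n} → z ⊨ F → z List.∈ Ω F
∈-Ω⁺ {F = F} {z} = List.∈-filter⁺ (_⊨? F) (∈-allAssignments z)

∈-Ω⁻ : {F : CNF n} {z : Assignment n} → z List.∈ Ω F → z ⊨ F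
∈-Ω⁻ {n} {F} = proj₂ ∘ List.∈-filter⁻ (_⊨? F) {xs = allAssignments n}

-- Take a clause violated after the flip. Any true literal at another variable would have survived
-- the flip, and a negated literal of `i` would have become true.
critical-clause : {F : CNF n} {z : Assignment n} {i : Fin n} → z ⊨ F → ¬ flip z i ⊨ F →
                  ∃ λ C → C List.∈ F × Critical z i C
critical-clause {F = F} {z} {i} z⊨F ¬flip
  with C , C∈F , ¬C ← List.find (All.¬All⇒Any¬ (flip z i ⊨ᶜ?_) F ¬flip)
  with j , j∈ ← All.lookup z⊨F C∈F
  = C , C∈F , record
    { literal   = subst (λ j → j ∈ lits (lookup z j) C) (only-i j∈) j∈
    ; only      = only-i
    ; unnegated = λ i∈ → ¬C (i , subst (λ b → i ∈ lits b C) (sym (lookup-flip z i)) i∈)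
    }
  where
  only-i : ∀ {j} → j ∈ lits (lookup z j) C → j ≡ i
  only-i {j} j∈ with j Fin.≟ i
  ... | yes j≡i = j≡i
  ... | no  j≢i = contradiction (j , subst (λ b → j ∈ lits b C) (sym (lookup-flip-≢ z j≢i)) j∈) ¬C

module _ {F : CNF n} {z : Assignment n} (z⊨F : z ⊨ F) where

  Isolated : Fin n → Set
  Isolated i = ∃ λ C → C List.∈ F × Critical z i C

  isolated? : ∀ i → (flip z i ⊨ F) ⊎ Isolated i
  isolated? i with flip z i ⊨? F
  ... | yes flip⊨F = inj₁ flip⊨F
  ... | no  ¬flip  = inj₂ (critical-clause z⊨F ¬flip)

  -- The event concerns the one critical clause selected by `isolated?`. Other clauses may force `i`
  -- too, but one is enough for a lower bound; directions of satisfying neighbours are never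
  -- counted.
  Forced : Vec (Fin n) n → Fin n → Set
  Forced π i = [ const Empty.⊥ , (λ (C , _) → Last (vars C) i π) ]′ (isolated? i)

  forced? : ∀ π i → Dec (Forced π i)
  forced? π i with isolated? i
  ... | inj₁ _       = no id
  ... | inj₂ (C , _) = last? (vars C) i π

  forced : Vec (Fin n) n → Subset n
  forced π = toSubset (forced? π)

  ppz-forced : (y : Assignment n) {π : Vec (Fin n) n} → Unique π →
               (∀ i → i ∉ forced π → lookup y i ≡ lookup z i) → ppz F y π ≡ z
  ppz-forced y {π} π! y≈z = trans (sym (Vec.tabulate∘lookup _)) (trans (Vec.tabulate-cong correct) (Vec.tabulate∘lookup z))
    where
    hyp : ∀ i → lookup y i ≡ lookup z i ⊎ ∃ λ C → C List.∈ F × Forcing z i π C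
    hyp i with i ∈? forced π
    ... | no i∉  = inj₁ (y≈z i i∉)
    ... | yes i∈ with isolated? i | ∈-toSubset⁻ (forced? π) i∈
    ...   | inj₂ (C , C∈F , crit) | l = inj₂ (C , C∈F , record
      { critical = crit ; scope = λ {j} _ → permutation-surjective π! j ; last = l })
    correct : ∀ i → lookup (ppz F y π) i ≡ lookup z i
    correct i = ppz-correct F z y π z⊨F π! (λ {i} _ → hyp i) (permutation-surjective π! i)

  -- Direction `i` leads out of `Ω F`, so it has a critical clause. Each of the at most `k`
  -- variables of this clause is equally likely to come last.
  #forced-≥ : ∀ {k} → IsKCNF k F → {i : Fin n} → i ∈ ∁ (nbrs (Ω F) z) →
              length (allPermutations n) ≤ k * ∑ (allPermutations n) (λ π → 𝟙 (i ∈? forced π))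
  #forced-≥ {k} F-kCNF {i} i∈∁ with isolated? i in eq
  ... | inj₁ flip⊨F = contradiction (∈-nbrs⁺ (Ω F) z (∈-Ω⁺ flip⊨F)) (x∈∁p⇒x∉p i∈∁)
  ... | inj₂ (C , C∈F , crit) = begin
    length perms                   ≤⟨ #last-≥ (lits⊆vars (lookup z i) (Critical.literal crit)) ⟩
    ∣ vars C ∣ * #last (vars C) i  ≤⟨ *-mono-≤ (≤-trans (∣p∪q∣≤∣p∣+∣q∣ (pos C) (neg C)) (All.lookup F-kCNF C∈F))
                                             (∑-mono perms λ {π} _ → 𝟙-mono (last? (vars C) i π) (i ∈? forced π) (last⇒forced π)) ⟩
    k * ∑ perms (λ π → 𝟙 (i ∈? forced π))  ∎
    where
    open ≤-Reasoning
    perms = allPermutations n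
    last⇒forced : ∀ π → Last (vars C) i π → i ∈ forced π
    last⇒forced π l = ∈-toSubset⁺ (forced? π) (subst [ const Empty.⊥ , (λ (C , _) → Last (vars C) i π) ]′ (sym eq) l)

  -- Linearity of expectation, as a double count of pairs of a permutation and a forced direction.
  ∑∣forced∣-≥ : ∀ {k} → IsKCNF k F →
                length (allPermutations n) * ∣ ∁ (nbrs (Ω F) z) ∣ ≤ k * ∑ (allPermutations n) (λ π → ∣ forced π ∣)
  ∑∣forced∣-≥ {k} F-kCNF = begin
    M * ∣ I ∣                                                   ≡⟨ cong (M *_) (∣p∣≡∑𝟙 I) ⟩
    M * ∑ (allFin n) (λ i → 𝟙 (i ∈? I))                         ≡⟨ ∑-*ˡ (allFin n) M _ ⟨
    ∑ (allFin n) (λ i → M * 𝟙 (i ∈? I))                         ≤⟨ ∑-mono (allFin n) (λ {i} _ → bound i) ⟩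
    ∑ (allFin n) (λ i → k * ∑ perms (λ π → 𝟙 (i ∈? forced π)))  ≡⟨ ∑-*ˡ (allFin n) k _ ⟩
    k * ∑ (allFin n) (λ i → ∑ perms (λ π → 𝟙 (i ∈? forced π)))  ≡⟨ cong (k *_) (∑-swap (allFin n) perms _) ⟩
    k * ∑ perms (λ π → ∑ (allFin n) (λ i → 𝟙 (i ∈? forced π)))
      ≡⟨ cong (k *_) (∑-cong perms (λ π → ∣p∣≡∑𝟙 (forced π))) ⟨
    k * ∑ perms (λ π → ∣ forced π ∣)                            ∎
    where
    open ≤-Reasoning
    perms = allPermutations n
    M = length perms
    I = ∁ (nbrs (Ω F) z)
    bound : ∀ i → M * 𝟙 (i ∈? I) ≤ k * ∑ perms (λ π → 𝟙 (i ∈? forced π))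
    bound i with i ∈? I
    ... | yes i∈I = ≤-trans (≤-reflexive (*-identityʳ M)) (#forced-≥ F-kCNF i∈I)
    ... | no  _   = ≤-trans (≤-reflexive (*-zeroʳ M)) z≤n

#output : CNF n → Assignment n → ℕ
#output {n} F z = ∑ (samples n) (λ (y , π) → 𝟙 (ppz F y π ≟ᵃ z))

-- For fixed `π`, every `y` agreeing with `z` off the forced set yields `z`, which gives
-- `2 ^ ∣ forced z⊨F π ∣` choices of `y`; `2^-jensen` passes to the mean exponent. The power of 2 on
-- the right replaces a subtraction of the number of neighbours on the left.
#output-≥ : ∀ {k} {F : CNF n} {z : Assignment n} → IsKCNF k F → z ⊨ F →
            length (allPermutations n) ^ k * 2 ^ n ≤ #output F z ^ k * 2 ^ ∣ nbrs (Ω F) z ∣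
#output-≥ {n} {k} {F} {z} F-kCNF z⊨F = begin
  M ^ k * 2 ^ n                                         ≡⟨ cong (λ m → M ^ k * 2 ^ m) (m∸n+n≡m (∣p∣≤n N)) ⟨
  M ^ k * 2 ^ (n ∸ ∣ N ∣ + ∣ N ∣)                       ≡⟨ cong (λ m → M ^ k * 2 ^ (m + ∣ N ∣)) (∣∁p∣≡n∸∣p∣ N) ⟨
  M ^ k * 2 ^ (∣ ∁ N ∣ + ∣ N ∣)                         ≡⟨ cong (M ^ k *_) (^-distribˡ-+-* 2 ∣ ∁ N ∣ ∣ N ∣) ⟩
  M ^ k * (2 ^ ∣ ∁ N ∣ * 2 ^ ∣ N ∣)                     ≡⟨ *-assoc (M ^ k) _ _ ⟨
  M ^ k * 2 ^ ∣ ∁ N ∣ * 2 ^ ∣ N ∣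
    ≤⟨ *-monoˡ-≤ (2 ^ ∣ N ∣) (2^-jensen k ∣ ∁ N ∣ (λ π → ∣ forced z⊨F π ∣) perms {{allPermutations-nonEmpty n}} (∑∣forced∣-≥ z⊨F F-kCNF)) ⟩
  ∑ perms (λ π → 2 ^ ∣ forced z⊨F π ∣) ^ k * 2 ^ ∣ N ∣  ≤⟨ *-monoˡ-≤ (2 ^ ∣ N ∣) (^-monoˡ-≤ k (∑-mono perms count)) ⟩
  ∑ perms (λ π → ∑ (allAssignments n) (λ y → 𝟙 (ppz F y π ≟ᵃ z))) ^ k * 2 ^ ∣ N ∣
    ≡⟨ cong (λ s → s ^ k * 2 ^ ∣ N ∣) (trans (∑-cartesianProductWith _,_ (allAssignments n) perms _) (∑-swap (allAssignments n) perms _)) ⟨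
  #output F z ^ k * 2 ^ ∣ N ∣  ∎
  where
  open ≤-Reasoning
  perms = allPermutations n
  M = length perms
  N = nbrs (Ω F) z
  count : ∀ {π} → π List.∈ perms → 2 ^ ∣ forced z⊨F π ∣ ≤ ∑ (allAssignments n) (λ y → 𝟙 (ppz F y π ≟ᵃ z))
  count {π} π∈ = 2^∣p∣≤∑𝟙 (forced z⊨F π) z (λ y → ppz F y π ≟ᵃ z) (λ y → ppz-forced z⊨F y (∈-allPermutations⁻ π∈))

-- Satisfying assignments far from z₀

∃-argmax : {A : Set} (f : A → ℕ) {x : A} {xs : List A} → x List.∈ xs →
           ∃ λ y → y List.∈ xs × (∀ {z} → z List.∈ xs → f z ≤ f y)
∃-argmax f {x} {xs} x∈xs = argmax f x xs , member (argmax-sel f x xs) , All.lookup (f[xs]≤f[argmax] x xs)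
  where
  member : argmax f x xs ≡ x ⊎ argmax f x xs List.∈ xs → argmax f x xs List.∈ xs
  member (inj₁ eq) = subst (List._∈ xs) (sym eq) x∈xs
  member (inj₂ ∈)  = ∈

∣p∣≤1+∣q∣ : {p q : Subset n} (i : Fin n) → (∀ {j} → j ≢ i → j ∈ p → j ∈ q) → ∣ p ∣ ≤ suc ∣ q ∣
∣p∣≤1+∣q∣ {n} {p} {q} i p-i⊆q = begin
  ∣ p ∣              ≤⟨ p⊆q⇒∣p∣≤∣q∣ p⊆ ⟩
  ∣ ⁅ i ⁆ ∪ q ∣      ≤⟨ ∣p∪q∣≤∣p∣+∣q∣ ⁅ i ⁆ q ⟩
  ∣ ⁅ i ⁆ ∣ + ∣ q ∣  ≡⟨ cong (_+ ∣ q ∣) (∣⁅x⁆∣≡1 i) ⟩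
  suc ∣ q ∣          ∎
  where
  open ≤-Reasoning
  p⊆ : p ⊆ ⁅ i ⁆ ∪ q
  p⊆ {j} j∈p with j Fin.≟ i
  ... | yes refl = x∈p∪q⁺ (inj₁ (x∈⁅x⁆ i))
  ... | no  j≢i  = x∈p∪q⁺ (inj₂ (p-i⊆q j≢i j∈p))

∈-flip⁻ : {p : Subset n} {i j : Fin n} → j ≢ i → j ∈ flip p i → j ∈ p
∈-flip⁻ {p = p} {i} {j} j≢i j∈ = Vec.lookup⇒[]= j p (trans (sym (lookup-flip-≢ p j≢i)) (Vec.[]=⇒lookup j∈))

module _ (z₀ : Assignment n) where

  diff : Assignment n → Subset n
  diff = zipWith _xor_ z₀

  diff-flip : ∀ z i → diff (flip z i) ≡ flip (diff z) i
  diff-flip = go z₀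
    where
    go : (x z : Assignment m) (i : Fin m) → zipWith _xor_ x (flip z i) ≡ flip (zipWith _xor_ x z) i
    go (x ∷ xs) (z ∷ zs) zero    = cong (_∷ _) (sym (Bool.not-distribʳ-xor x z))
    go (x ∷ xs) (z ∷ zs) (suc i) = cong (_ ∷_) (go xs zs i)

  ∈-diff-cong : ∀ {y z i} → lookup y i ≡ lookup z i → i ∈ diff y → i ∈ diff z
  ∈-diff-cong {y} {z} {i} y≡z i∈ = Vec.lookup⇒[]= i _
    (trans (Vec.lookup-zipWith _xor_ i z₀ z)
    (trans (cong (lookup z₀ i xor_) (sym y≡z))
    (trans (sym (Vec.lookup-zipWith _xor_ i z₀ y)) (Vec.[]=⇒lookup i∈))))

  -- Flipping a coordinate at which `z` agrees with `z₀` would increase the distance.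
  flip-closer : ∀ {z i} → d-H z₀ (flip z i) ≤ d-H z₀ z → i ∈ diff z
  flip-closer {z} {i} d≤ with i ∈? diff z
  ... | yes i∈ = i∈
  ... | no  i∉ = contradiction (subst (_≤ d-H z₀ z) (trans (cong ∣_∣ (diff-flip z i)) (∣flip∣-∉ i∉)) d≤) 1+n≰n

  d-H-flip : ∀ {z i} → i ∈ diff z → suc (d-H z₀ (flip z i)) ≡ d-H z₀ z
  d-H-flip {z} {i} i∈ = trans (cong (suc ∘ ∣_∣) (diff-flip z i)) (∣flip∣-∈ i∈)

∉-flip : {p : Subset n} {i : Fin n} → i ∈ p → i ∉ flip p i
∉-flip (there i∈) (there i∈′) = ∉-flip i∈ i∈′
∉-flip here ()

module _ (L : List (Assignment n)) (z : Assignment n) (i : Fin n) (Q : Bool → Set) (Q? : ∀ b → Dec (Q b)) where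
  -- Only the neighbour in direction `i` can be lost, because all others share the `i`-th value of
  -- `z`. The predicate `Q` is left general to cover both halves of the split.
  ∣nbrs∣-filter : Q (lookup z i) → ∣ nbrs L z ∣ ≤ suc ∣ nbrs (filter (λ x → Q? (lookup x i)) L) z ∣
  ∣nbrs∣-filter Qz = ∣p∣≤1+∣q∣ i λ {j} j≢i j∈ → ∈-nbrs⁺ (filter (λ x → Q? (lookup x i)) L) z
    (List.∈-filter⁺ (λ x → Q? (lookup x i)) (∈-nbrs⁻ L z j∈) (subst Q (sym (lookup-flip-≢ z (j≢i ∘ sym))) Qz))

-- d is the maximal distance, t the least distance counted, and c the number of
-- fixed coordinates at which all the remaining assignments differ from z₀.
deficit : (k t d c : ℕ) → ℕ
deficit k t d c = (d ∸ c) ∸ k * (d ∸ t)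

m∸n≡suc : ∀ {m n} → n < m → m ∸ n ≡ suc (m ∸ suc n)
m∸n≡suc {m} {n} n<m = +-∸-assoc 1 n<m

-- The strict inequality keeps the truncated subtractions exact when one more coordinate is fixed.
deficit-suc : ∀ k t {d c} → c < d → k * (d ∸ t) < d ∸ c → suc (deficit k t d (suc c)) ≡ deficit k t d c
deficit-suc k t {d} {c} c<d kr<D =
  trans (sym (+-∸-assoc 1 (s≤s⁻¹ (subst (k * (d ∸ t) <_) (m∸n≡suc c<d) kr<D))))
        (cong (_∸ k * (d ∸ t)) (sym (m∸n≡suc c<d)))

-- The deficit at `d` is 0. Lowering `d` by one lowers `d ∸ c` by one and `k * (d ∸ t)` by `k`, so
-- the deficit becomes at most `k ∸ 1`.
deficit-pred : ∀ k .{{_ : NonZero k}} t {d d′ c} → d ∸ c ≤ k * (d ∸ t) → d ≡ d′ ⊎ (d ≡ suc d′ × t ≤ d′ × c ≤ d′) → deficit k t d′ c < k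
deficit-pred k t D≤kr (inj₁ refl) = subst (_< k) (sym (m≤n⇒m∸n≡0 D≤kr)) (>-nonZero⁻¹ k)
deficit-pred k t {d′ = d′} {c} D≤kr (inj₂ (refl , t≤d′ , c≤d′)) = m<n+o⇒m∸n<o (d′ ∸ c) (k * (d′ ∸ t)) (begin
  suc (d′ ∸ c)      ≡⟨ +-∸-assoc 1 c≤d′ ⟨
  suc d′ ∸ c        ≤⟨ D≤kr ⟩
  k * (suc d′ ∸ t)  ≡⟨ cong (k *_) (+-∸-assoc 1 t≤d′) ⟩
  k * suc (d′ ∸ t)  ≡⟨ *-suc k (d′ ∸ t) ⟩
  k + k * (d′ ∸ t)  ≡⟨ +-comm k _ ⟩
  k * (d′ ∸ t) + k  ∎)
  where open ≤-Reasoning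

-- J is the set of fixed coordinates counted by c above, and e the number of splits
-- made so far.
∑-weights-≥ : (z₀ : Assignment n) (k : ℕ) .{{_ : NonZero k}} (t B : ℕ) (W : Assignment n → ℕ) →
  (l : ℕ) (L : List (Assignment n)) → length L ≤ l →
  (J : Subset n) → (∀ {z} → z List.∈ L → J ⊆ diff z₀ z) →
  ∀ {z′} → z′ List.∈ L → (∀ {z} → z List.∈ L → d-H z₀ z ≤ d-H z₀ z′) → t ≤ d-H z₀ z′ →
  (e : ℕ) → (∀ {z} → z List.∈ L → t ≤ d-H z₀ z → B ≤ W z ^ k * 2 ^ (e + ∣ nbrs L z ∣)) →
  B ≤ ∑ L W ^ k * 2 ^ (e + deficit k t (d-H z₀ z′) ∣ J ∣)
∑-weights-≥ z₀ k t B W zero [] _ J J⊆ ()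
∑-weights-≥ {n} z₀ k t B W (suc l) L ∣L∣≤l J J⊆ {z′} z′∈L z′-max t≤d e W-≥ with nonempty? (nbrs L z′)
-- Without neighbours the term of `z′` alone gives the bound, whatever the deficit.
... | no no-nbrs = begin
  B                                   ≤⟨ W-≥ z′∈L t≤d ⟩
  W z′ ^ k * 2 ^ (e + ∣ nbrs L z′ ∣)  ≤⟨ *-mono-≤ (^-monoˡ-≤ k (∑-∈ W z′∈L)) (^-monoʳ-≤ 2 (+-monoʳ-≤ e deg≤)) ⟩
  ∑ L W ^ k * 2 ^ (e + _)             ∎
  where
  open ≤-Reasoning
  deg≤ : ∀ {x} → ∣ nbrs L z′ ∣ ≤ x
  deg≤ = subst (_≤ _) (sym (trans (cong ∣_∣ (Empty-unique no-nbrs)) (∣⊥∣≡0 n))) z≤n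
... | yes (i , i∈nbrs) = by-deficit
  where
  open ≤-Reasoning
  d = d-H z₀
  w = flip z′ i
  w∈L : w List.∈ L
  w∈L = ∈-nbrs⁻ L z′ i∈nbrs
  i∈diff : i ∈ diff z₀ z′
  i∈diff = flip-closer z₀ (z′-max w∈L)
  1+dw≡d : suc (d w) ≡ d z′
  1+dw≡d = d-H-flip z₀ i∈diff
  -- All members of `L` differ from `z₀` on `J`, whereas `w` agrees with `z₀` at `i`.
  i∉J : i ∉ J
  i∉J i∈J = ∉-flip i∈diff (subst (i ∈_) (diff-flip z₀ z′ i) (J⊆ w∈L i∈J))

  Same? : (z : Assignment n) → Dec (lookup z i ≡ lookup z′ i)
  Same? z = lookup z i Bool.≟ lookup z′ i
  L₁ = filter Same? L
  L₀ = filter (¬? ∘ Same?) L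
  L₁⊆ : ∀ {z} → z List.∈ L₁ → z List.∈ L × lookup z i ≡ lookup z′ i
  L₁⊆ = List.∈-filter⁻ Same? {xs = L}
  L₀⊆ : ∀ {z} → z List.∈ L₀ → z List.∈ L × lookup z i ≢ lookup z′ i
  L₀⊆ = List.∈-filter⁻ (¬? ∘ Same?) {xs = L}
  w-differs : lookup w i ≢ lookup z′ i
  w-differs eq = Bool.not-¬ refl (trans (sym eq) (lookup-flip z′ i))
  w∈L₀ : w List.∈ L₀
  w∈L₀ = List.∈-filter⁺ (¬? ∘ Same?) w∈L w-differs
  -- Each half is strictly shorter than `L`: one lacks `w`, the other lacks `z′`. So the recursion
  -- on the length bound `l` can proceed.
  ∣L₁∣≤l : length L₁ ≤ l
  ∣L₁∣≤l = s≤s⁻¹ (≤-trans (List.filter-notAll Same? L (Any.map (λ { refl → w-differs }) w∈L)) ∣L∣≤l)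
  ∣L₀∣≤l : length L₀ ≤ l
  ∣L₀∣≤l = s≤s⁻¹ (≤-trans (List.filter-notAll (¬? ∘ Same?) L (Any.map (λ { refl ¬eq → ¬eq refl }) z′∈L)) ∣L∣≤l)

  -- As `i` is not in `J`, the flip inserts it.
  J₁ = flip J i
  J₁⊆ : ∀ {z} → z List.∈ L₁ → J₁ ⊆ diff z₀ z
  J₁⊆ z∈L₁ {j} j∈ with j Fin.≟ i
  ... | yes refl = ∈-diff-cong z₀ (sym (proj₂ (L₁⊆ z∈L₁))) i∈diff
  ... | no  j≢i  = J⊆ (proj₁ (L₁⊆ z∈L₁)) (∈-flip⁻ j≢i j∈)
  ∣J∣<d : ∣ J ∣ < d z′
  ∣J∣<d = subst (_≤ d z′) (∣flip∣-∉ i∉J) (p⊆q⇒∣p∣≤∣q∣ (J₁⊆ (List.∈-filter⁺ Same? z′∈L refl)))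

  -- The neighbour that a split may cost is paid for by raising `e` by one.
  e+≤ : ∀ {x y} → x ≤ suc y → e + x ≤ suc e + y
  e+≤ {x} {y} x≤ = ≤-trans (+-monoʳ-≤ e x≤) (≤-reflexive (+-suc e y))
  W-≥₁ : ∀ {z} → z List.∈ L₁ → t ≤ d z → B ≤ W z ^ k * 2 ^ (suc e + ∣ nbrs L₁ z ∣)
  W-≥₁ {z} z∈ t≤ with z∈L , same ← L₁⊆ z∈ = ≤-trans (W-≥ z∈L t≤)
    (*-monoʳ-≤ (W z ^ k) (^-monoʳ-≤ 2 (e+≤ (∣nbrs∣-filter L z i (_≡ lookup z′ i) (Bool._≟ lookup z′ i) same))))
  W-≥₀ : ∀ {z} → z List.∈ L₀ → t ≤ d z → B ≤ W z ^ k * 2 ^ (suc e + ∣ nbrs L₀ z ∣)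
  W-≥₀ {z} z∈ t≤ with z∈L , differs ← L₀⊆ z∈ = ≤-trans (W-≥ z∈L t≤)
    (*-monoʳ-≤ (W z ^ k) (^-monoʳ-≤ 2 (e+≤ (∣nbrs∣-filter L z i (_≢ lookup z′ i) (¬? ∘ (Bool._≟ lookup z′ i)) differs))))

  bound₁ : B ≤ ∑ L₁ W ^ k * 2 ^ (suc e + deficit k t (d z′) (suc ∣ J ∣))
  bound₁ = subst (λ c → B ≤ ∑ L₁ W ^ k * 2 ^ (suc e + deficit k t (d z′) c)) (∣flip∣-∉ i∉J)
    (∑-weights-≥ z₀ k t B W l L₁ ∣L₁∣≤l J₁ J₁⊆ (List.∈-filter⁺ Same? z′∈L refl) (z′-max ∘ proj₁ ∘ L₁⊆) t≤d (suc e) W-≥₁)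

  by-deficit : B ≤ ∑ L W ^ k * 2 ^ (e + deficit k t (d z′) ∣ J ∣)
  by-deficit with k * (d z′ ∸ t) <? d z′ ∸ ∣ J ∣
  -- In the half of `z′` the increase of `e` is cancelled by the decrease of the deficit.
  ... | yes kr<D = begin
    B                                                          ≤⟨ bound₁ ⟩
    ∑ L₁ W ^ k * 2 ^ (suc e + deficit k t (d z′) (suc ∣ J ∣))
      ≤⟨ *-mono-≤ (^-monoˡ-≤ k L₁≤L) (≤-reflexive (cong (2 ^_) exponent)) ⟩
    ∑ L W ^ k * 2 ^ (e + deficit k t (d z′) ∣ J ∣)             ∎
    where
    L₁≤L : ∑ L₁ W ≤ ∑ L W
    L₁≤L = ≤-trans (m≤m+n _ _) (≤-reflexive (∑-filter-¬ Same? L W))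
    exponent : suc e + deficit k t (d z′) (suc ∣ J ∣) ≡ e + deficit k t (d z′) ∣ J ∣
    exponent = trans (sym (+-suc e _)) (cong (e +_) (deficit-suc k t ∣J∣<d kr<D))
  -- The half of `z′` has deficit 0 and the other half has deficit `g < k`. The two exponents
  -- together exceed `2 * e` by `2 + g`, within the `2 * k` that `merge` grants.
  ... | no kr≮D with z″ , z″∈L₀ , z″-max ← ∃-argmax d w∈L₀ =
    subst (λ s → B ≤ s ^ k * 2 ^ (e + deficit k t (d z′) ∣ J ∣)) (∑-filter-¬ Same? L W)
      (merge k _ _ (e + deficit k t (d z′) ∣ J ∣) bound₁ bound₀ exponents)
    where
    D≤kr : d z′ ∸ ∣ J ∣ ≤ k * (d z′ ∸ t)
    D≤kr = ≮⇒≥ kr≮D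
    dw≤ : d w ≤ d z″
    dw≤ = z″-max w∈L₀
    -- It suffices that `t < d z′`. If `t` were equal to `d z′`, then `D≤kr` would give
    -- `d z′ ∸ ∣ J ∣ ≤ 0`, against `∣J∣<d`.
    t≤dw : t ≤ d w
    t≤dw = s≤s⁻¹ (subst (t <_) (sym 1+dw≡d) (≤∧≢⇒< t≤d λ { refl →
      <⇒≱ (m<n⇒0<n∸m ∣J∣<d) (≤-trans D≤kr (≤-reflexive (trans (cong (k *_) (n∸n≡0 t)) (*-zeroʳ k)))) }))
    bound₀ : B ≤ ∑ L₀ W ^ k * 2 ^ (suc e + deficit k t (d z″) ∣ J ∣)
    bound₀ = ∑-weights-≥ z₀ k t B W l L₀ ∣L₀∣≤l J (J⊆ ∘ proj₁ ∘ L₀⊆) z″∈L₀ z″-max (≤-trans t≤dw dw≤) (suc e) W-≥₀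
    z″-cases : d z′ ≡ d z″ ⊎ (d z′ ≡ suc (d z″) × t ≤ d z″ × ∣ J ∣ ≤ d z″)
    z″-cases with m≤n⇒m<n∨m≡n dw≤
    ... | inj₁ dw<d″ = inj₁ (≤-antisym (subst (_≤ d z″) 1+dw≡d dw<d″) (z′-max (proj₁ (L₀⊆ z″∈L₀))))
    ... | inj₂ dw≡d″ = inj₂ (trans (sym 1+dw≡d) (cong suc dw≡d″) , ≤-trans t≤dw dw≤ , s≤s⁻¹ (subst (∣ J ∣ <_) (trans (sym 1+dw≡d) (cong suc dw≡d″)) ∣J∣<d))
    g = deficit k t (d z″) ∣ J ∣
    g<k : g < k
    g<k = deficit-pred k t D≤kr z″-cases
    g₁≡0 : deficit k t (d z′) (suc ∣ J ∣) ≡ 0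
    g₁≡0 = m≤n⇒m∸n≡0 (≤-trans (∸-monoʳ-≤ (d z′) (n≤1+n ∣ J ∣)) D≤kr)
    exponents : suc e + deficit k t (d z′) (suc ∣ J ∣) + (suc e + g) ≤ 2 * k + 2 * (e + deficit k t (d z′) ∣ J ∣)
    exponents = begin
      suc e + deficit k t (d z′) (suc ∣ J ∣) + (suc e + g)  ≡⟨ cong (λ x → suc e + x + (suc e + g)) g₁≡0 ⟩
      suc e + 0 + (suc e + g)                               ≡⟨ eq e g ⟩
      1 + suc g + 2 * e                                     ≤⟨ +-monoˡ-≤ (2 * e) (+-mono-≤ (>-nonZero⁻¹ k) g<k) ⟩
      k + k + 2 * e                                         ≡⟨ cong (λ x → k + x + 2 * e) (+-identityʳ k) ⟨
      2 * k + 2 * e                                         ≤⟨ +-monoʳ-≤ (2 * k) (*-monoʳ-≤ 2 (m≤m+n e _)) ⟩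
      2 * k + 2 * (e + deficit k t (d z′) ∣ J ∣)            ∎
      where
      eq : ∀ e g → suc e + 0 + (suc e + g) ≡ 1 + suc g + 2 * e
      eq = solve-∀

-- Passing to rationals

open import Data.Integer.Base using (+_)
open import Data.Rational.Base using (_/_)

toℚᵘ-/ : ∀ i d-1 → toℚᵘ (i / suc d-1) ℚᵘ.≃ mkℚᵘ i d-1
toℚᵘ-/ i d-1 = ℚ.toℚᵘ-fromℚᵘ (mkℚᵘ i d-1)

/-mono-≤ : ∀ a b c d .{{_ : NonZero b}} .{{_ : NonZero d}} → a * d ≤ c * b → + a / b ℚ.≤ + c / d
/-mono-≤ a (suc b) c (suc d) ad≤cb = ℚ.toℚᵘ-cancel-≤
  (ℚᵘ.≤-respˡ-≃ (ℚᵘ.≃-sym (toℚᵘ-/ (+ a) b)) (ℚᵘ.≤-respʳ-≃ (ℚᵘ.≃-sym (toℚᵘ-/ (+ c) d))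
    (*≤* (subst₂ ℤ._≤_ (ℤ.pos-* a (suc d)) (ℤ.pos-* c (suc b)) (ℤ.+≤+ ad≤cb)))))

/-*-/ : ∀ a b c d .{{_ : NonZero b}} .{{_ : NonZero d}} →
        (+ a / b) ℚ.* (+ c / d) ≡ (+ (a * c) / (b * d)) {{m*n≢0 b d}}
/-*-/ a (suc b) c (suc d) = ℚ.toℚᵘ-injective (begin
  toℚᵘ ((+ a / suc b) ℚ.* (+ c / suc d))      ≈⟨ ℚ.toℚᵘ-homo-* (+ a / suc b) (+ c / suc d) ⟩
  toℚᵘ (+ a / suc b) ℚᵘ.* toℚᵘ (+ c / suc d)  ≈⟨ ℚᵘ.*-cong (toℚᵘ-/ (+ a) b) (toℚᵘ-/ (+ c) d) ⟩
  mkℚᵘ (+ a) b ℚᵘ.* mkℚᵘ (+ c) d              ≡⟨ cong (λ i → mkℚᵘ i _) (ℤ.pos-* a c) ⟨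
  mkℚᵘ (+ (a * c)) (d + b * suc d)            ≈⟨ toℚᵘ-/ (+ (a * c)) (d + b * suc d) ⟨
  toℚᵘ (+ (a * c) / (suc b * suc d))          ∎)
  where open ℚᵘ.≃-Reasoning

/-^ : ∀ a b k .{{_ : NonZero b}} → (+ a / b) ^ℚ k ≡ (+ (a ^ k) / (b ^ k)) {{m^n≢0 b k}}
/-^ a b zero    = refl
/-^ a b (suc k) = trans (cong ((+ a / b) ℚ.*_) (/-^ a b k)) (/-*-/ a b (a ^ k) (b ^ k))
  where instance _ = m^n≢0 b k

1-1/k : ∀ k .{{_ : NonZero k}} → 1ℚ ℚ.- (+ 1 / k) ≡ + (k ∸ 1) / k
1-1/k (suc k) = ℚ.toℚᵘ-injective (begin
  toℚᵘ (1ℚ ℚ.- (+ 1 / suc k))            ≈⟨ ℚ.toℚᵘ-homo-+ 1ℚ (ℚ.- (+ 1 / suc k)) ⟩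
  toℚᵘ 1ℚ ℚᵘ.+ toℚᵘ (ℚ.- (+ 1 / suc k))
    ≈⟨ ℚᵘ.+-congʳ (toℚᵘ 1ℚ) (ℚᵘ.≃-trans (ℚ.toℚᵘ-homo‿- (+ 1 / suc k)) (ℚᵘ.-‿cong (toℚᵘ-/ (+ 1) k))) ⟩
  mkℚᵘ (+ 1) 0 ℚᵘ.- mkℚᵘ (+ 1) k
    ≈⟨ *≡* (cong₂ ℤ._*_ (cong (ℤ._+ ℤ.-1ℤ) (ℤ.*-identityˡ (+ suc k))) (cong +_ (sym (*-identityˡ (suc k))))) ⟩
  mkℚᵘ (+ k) k                           ≈⟨ toℚᵘ-/ (+ k) k ⟨
  toℚᵘ (+ k / suc k)                     ∎)
  where open ℚᵘ.≃-Reasoning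

Pr-nonEmpty : {A : Set} {P : Pred A 0ℓ} (xs : List A) (P? : Decidable P) .{{_ : NonZero (length xs)}} →
              Pr xs P? ≡ + length (filter P? xs) / length xs
Pr-nonEmpty (_ ∷ _) P? = refl

-- The quotient is rounded down, so `k * (D ℕ./ k) ≤ D`, and the integral threshold is no smaller
-- than the rational one.
threshold-good : ∀ k .{{_ : NonZero k}} D {m d} → m ≤ D → D ∸ D ℕ./ k ≤ d →
                 (1ℚ ℚ.- + 1 / k) ℚ.* (+ m / 1) ℚ.≤ + d / 1
threshold-good k D {m} {d} m≤D D≤ = subst (ℚ._≤ + d / 1)
  (sym (trans (cong (ℚ._* (+ m / 1)) (1-1/k k)) (/-*-/ (k ∸ 1) k m 1)))
  (/-mono-≤ ((k ∸ 1) * m) (k * 1) d 1 {{m*n≢0 k 1}} (begin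
    (k ∸ 1) * m * 1        ≡⟨ *-identityʳ _ ⟩
    (k ∸ 1) * m            ≤⟨ *-monoʳ-≤ (k ∸ 1) m≤D ⟩
    (k ∸ 1) * D            ≡⟨ *-distribʳ-∸ D k 1 ⟩
    k * D ∸ 1 * D          ≡⟨ cong (k * D ∸_) (*-identityˡ D) ⟩
    k * D ∸ D              ≤⟨ ∸-monoʳ-≤ (k * D) (m/n*n≤m D k) ⟩
    k * D ∸ D ℕ./ k * k    ≡⟨ cong (k * D ∸_) (*-comm (D ℕ./ k) k) ⟩
    k * D ∸ k * (D ℕ./ k)  ≡⟨ *-distribˡ-∸ k D (D ℕ./ k) ⟨
    k * (D ∸ D ℕ./ k)      ≤⟨ *-monoʳ-≤ k D≤ ⟩
    k * d                  ≡⟨ *-comm k d ⟩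
    d * k                  ≡⟨ cong (d *_) (*-identityʳ k) ⟨
    d * (k * 1)            ∎))
  where open ≤-Reasoning

-- With this threshold `d ∸ t` is the quotient `D ℕ./ k`, so the deficit is the remainder of `D`
-- modulo `k`.
deficit-threshold : ∀ k .{{_ : NonZero k}} D → deficit k (D ∸ D ℕ./ k) D 0 ≤ k
deficit-threshold k D = m≤n+o⇒m∸n≤o D (k * (D ∸ (D ∸ D ℕ./ k))) (begin
  D                            ≡⟨ m≡m%n+[m/n]*n D k ⟩
  D % k + D ℕ./ k * k          ≤⟨ +-monoˡ-≤ _ (<⇒≤ (m%n<n D k)) ⟩
  k + D ℕ./ k * k              ≡⟨ +-comm k _ ⟩
  D ℕ./ k * k + k              ≡⟨ cong (_+ k) (*-comm (D ℕ./ k) k) ⟩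
  k * (D ℕ./ k) + k            ≡⟨ cong (λ r → k * r + k) (m∸[m∸n]≡n (m/n≤m D k)) ⟨
  k * (D ∸ (D ∸ D ℕ./ k)) + k  ∎)
  where open ≤-Reasoning

-- The success probability of one iteration

length-allAssignments : ∀ n → length (allAssignments n) ≡ 2 ^ n
length-allAssignments zero    = refl
length-allAssignments (suc n) = begin
  length (allAssignments (suc n))
    ≡⟨ trans (∑-const (allAssignments (suc n)) 1) (*-identityʳ _) ⟨
  ∑ (allAssignments (suc n)) (λ _ → 1)
    ≡⟨ ∑-cartesianProductWith _∷ᵛ_ (false ∷ true ∷ []) (allAssignments n) _ ⟩
  ∑ (false ∷ true ∷ []) (λ _ → ∑ (allAssignments n) (λ _ → 1))
    ≡⟨ cong (2 *_) (trans (∑-const (allAssignments n) 1) (*-identityʳ (length (allAssignments n)))) ⟩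
  2 * length (allAssignments n)                                 ≡⟨ cong (2 *_) (length-allAssignments n) ⟩
  2 ^ suc n                                                     ∎
  where
  open ≡-Reasoning
  open import Data.Vec.Base using () renaming (_∷_ to _∷ᵛ_)

length-samples : ∀ n → length (samples n) ≡ 2 ^ n * length (allPermutations n)
length-samples n = begin
  length (samples n)                                            ≡⟨ trans (∑-const (samples n) 1) (*-identityʳ _) ⟨
  ∑ (samples n) (λ _ → 1)
    ≡⟨ ∑-cartesianProductWith _,_ (allAssignments n) (allPermutations n) _ ⟩
  ∑ (allAssignments n) (λ _ → ∑ (allPermutations n) (λ _ → 1))  ≡⟨ ∑-const (allAssignments n) _ ⟩
  length (allAssignments n) * ∑ (allPermutations n) (λ _ → 1)
    ≡⟨ cong₂ _*_ (length-allAssignments n) (trans (∑-const (allPermutations n) 1) (*-identityʳ _)) ⟩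
  2 ^ n * length (allPermutations n)                            ∎
  where open ≡-Reasoning

∑-𝟙-×-unique : {A : Set} {xs : List A} {P : A → Set} {Q : Set} (P? : ∀ x → Dec (P x)) (Q? : Dec Q) →
               List.Unique xs → (∀ {x y} → P x → P y → x ≡ y) → ∑ xs (λ x → 𝟙 (P? x ×-dec Q?)) ≤ 𝟙 Q?
∑-𝟙-×-unique P? Q?@(yes _) xs! P-unique =
  ∑-𝟙-unique (λ x → P? x ×-dec Q?) xs! λ (Px , _) (Py , _) → P-unique Px Py
∑-𝟙-×-unique {xs = xs} P? Q?@(no ¬q) xs! P-unique = ≤-trans
  (∑-mono xs λ {x} _ → 𝟙-mono (P? x ×-dec Q?) Q? proj₂)
  (≤-reflexive (trans (∑-const xs 0) (*-zeroʳ (length xs))))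

module _ {n k : ℕ} .{{_ : NonZero k}} {F : CNF n} (F-kCNF : IsKCNF k F) {P : Pred (Assignment n) 0ℓ} (P? : Decidable P) where

  -- The conjunct `P` gives weight 0 to assignments outside `P`, so that weights can be summed over
  -- all of `Ω F`.
  Output : Assignment n → Sample n → Set
  Output z (y , π) = ppz F y π ≡ z × P (ppz F y π)

  output? : ∀ z s → Dec (Output z s)
  output? z (y , π) = (ppz F y π ≟ᵃ z) ×-dec P? (ppz F y π)

  #success : ℕ
  #success = length (filter (λ (y , π) → P? (ppz F y π)) (samples n))

  -- Each sample has a single output, so it is counted for at most one `z`, and only if that output
  -- satisfies `P`.
  ∑-output≤#success : ∑ (Ω F) (λ z → ∑ (samples n) (λ s → 𝟙 (output? z s))) ≤ #success
  ∑-output≤#success = begin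
    ∑ (Ω F) (λ z → ∑ (samples n) (λ s → 𝟙 (output? z s)))  ≡⟨ ∑-swap (Ω F) (samples n) _ ⟩
    ∑ (samples n) (λ s → ∑ (Ω F) (λ z → 𝟙 (output? z s)))  ≤⟨ ∑-mono (samples n) (λ { {y , π} _ →
      ∑-𝟙-×-unique (ppz F y π ≟ᵃ_) (P? (ppz F y π)) Ω! (λ e e′ → trans (sym e) e′) }) ⟩
    ∑ (samples n) (λ (y , π) → 𝟙 (P? (ppz F y π)))  ≡⟨ length-filter-∑ (λ (y , π) → P? (ppz F y π)) (samples n) ⟨
    #success                                        ∎
    where
    open ≤-Reasoning
    Ω! = UniqueList.filter⁺ (_⊨? F) (allAssignments-unique n)

  -- Divided by the `k`-th power of the number of samples, this bounds the success probability from
  -- below by one half times 2 to the power `-(1 - 1/k) n`.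
  #success-≥ : (z₀ : Assignment n) {z′ : Assignment n} → z′ List.∈ Ω F →
               (let D = d-H z₀ z′) → (∀ {z} → z List.∈ Ω F → d-H z₀ z ≤ D) →
               (∀ {z} → z List.∈ Ω F → D ∸ D ℕ./ k ≤ d-H z₀ z → P z) →
               length (allPermutations n) ^ k * 2 ^ n ≤ #success ^ k * 2 ^ k
  #success-≥ z₀ {z′} z′∈ z′-max P-far = begin
    M ^ k * 2 ^ n
      -- At the start no coordinate is fixed and no split has been made: `J` is `⊥` and `e` is 0.
      ≤⟨ ∑-weights-≥ z₀ k t (M ^ k * 2 ^ n) W (length (Ω F)) (Ω F) ≤-refl ⊥ (λ _ → ⊥⊆)
           z′∈ z′-max (m∸n≤m D (D ℕ./ k)) 0 W-≥ ⟩
    ∑ (Ω F) W ^ k * 2 ^ deficit k t D ∣ ⊥ {n} ∣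
      ≤⟨ *-mono-≤ (^-monoˡ-≤ k ∑-output≤#success)
           (^-monoʳ-≤ 2 (subst (λ c → deficit k t D c ≤ k) (sym (∣⊥∣≡0 n)) (deficit-threshold k D))) ⟩
    #success ^ k * 2 ^ k  ∎
    where
    open ≤-Reasoning
    M = length (allPermutations n)
    D = d-H z₀ z′
    t = D ∸ D ℕ./ k
    W : Assignment n → ℕ
    W z = ∑ (samples n) (λ s → 𝟙 (output? z s))
    W-≥ : ∀ {z} → z List.∈ Ω F → t ≤ d-H z₀ z → M ^ k * 2 ^ n ≤ W z ^ k * 2 ^ ∣ nbrs (Ω F) z ∣
    W-≥ {z} z∈ t≤d = ≤-trans (#output-≥ F-kCNF (∈-Ω⁻ z∈)) (*-monoˡ-≤ _ (^-monoˡ-≤ k (∑-mono (samples n)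
      λ { {y , π} _ → 𝟙-mono (ppz F y π ≟ᵃ z) (output? z (y , π)) λ { refl → refl , P-far z∈ t≤d } })))

#good-≥ : ∀ {n k} .{{_ : NonZero k}} {F : CNF n} (F-kCNF : IsKCNF k F) → Satisfiable F → (z₀ : Assignment n) →
          length (allPermutations n) ^ k * 2 ^ n ≤ #success F-kCNF (good? k F z₀) ^ k * 2 ^ k
#good-≥ {k = k} {F} F-kCNF (z , z⊨F) z₀ =
  let z′ , z′∈ , z′-max = ∃-argmax (d-H z₀) (∈-Ω⁺ {F = F} {z} z⊨F) in
  #success-≥ F-kCNF (good? k F z₀) z₀ z′∈ z′-max λ {z} z∈ t≤d →
    ∈-Ω⁻ {F = F} {z} z∈ , threshold-good k (d-H z₀ z′) (max≤v⁺ z≤n (All.map⁺ (All.tabulate z′-max))) t≤d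

lemma1 : (n k : ℕ) .{{_ : NonZero n}} .{{_ : NonZero k}} →
    (F : CNF n) → IsKCNF k F → Satisfiable F →
    (z₀ : Assignment n) →
    PrPPZ F (good? k F z₀) ≥ (+ 1 / (2 * n)) {{m*n≢0 2 n}} ·2^-[ (k ∸ 1) * n / k ]
lemma1 n k F F-kCNF sat z₀ = subst₂ ℚ._≤_ (sym lhs) (sym rhs)
  (/-mono-≤ (1 ^ k * 1 ^ a) ((2 * n) ^ k * 2 ^ a) (G ^ k) (N ^ k) (begin
    1 ^ k * 1 ^ a * N ^ k          ≡⟨ cong₂ (λ x y → x * y * N ^ k) (^-zeroˡ k) (^-zeroˡ a) ⟩
    1 * 1 * N ^ k                  ≡⟨ *-identityˡ (N ^ k) ⟩
    N ^ k                          ≡⟨ cong (_^ k) (length-samples n) ⟩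
    (2 ^ n * M) ^ k                ≡⟨ ^-distribʳ-* k (2 ^ n) M ⟩
    (2 ^ n) ^ k * M ^ k            ≡⟨ cong (_* M ^ k) 2^nk ⟩
    2 ^ n * 2 ^ a * M ^ k          ≡⟨ eq₁ (2 ^ n) (2 ^ a) (M ^ k) ⟩
    M ^ k * 2 ^ n * 2 ^ a          ≤⟨ *-monoˡ-≤ (2 ^ a) (#good-≥ F-kCNF sat z₀) ⟩
    -- The constant one half reached so far is weakened to the stated `1 / (2 * n)`.
    G ^ k * 2 ^ k * 2 ^ a          ≤⟨ *-monoˡ-≤ (2 ^ a) (*-monoʳ-≤ (G ^ k) (^-monoˡ-≤ k (m≤m*n 2 n))) ⟩
    G ^ k * (2 * n) ^ k * 2 ^ a    ≡⟨ *-assoc (G ^ k) _ _ ⟩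
    G ^ k * ((2 * n) ^ k * 2 ^ a)  ∎))
  where
  open ≤-Reasoning
  M = length (allPermutations n)
  N = length (samples n)
  G = #success F-kCNF (good? k F z₀)
  a = (k ∸ 1) * n
  instance
    _ = m*n≢0 2 n
    _ = m^n≢0 (2 * n) k
    _ = m^n≢0 2 a
    _ = m*n≢0 ((2 * n) ^ k) (2 ^ a)
    N≢0 : NonZero N
    N≢0 = subst NonZero (sym (length-samples n)) (m*n≢0 (2 ^ n) M {{m^n≢0 2 n}} {{allPermutations-nonEmpty n}})
    _ = m^n≢0 N k
  eq₁ : ∀ x y z → x * y * z ≡ z * x * y
  eq₁ = solve-∀
  2^nk : (2 ^ n) ^ k ≡ 2 ^ n * 2 ^ a
  2^nk = trans (^-*-assoc 2 n k) (trans (cong (2 ^_) nk) (^-distribˡ-+-* 2 n a))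
    where
    nk : n * k ≡ n + a
    nk = trans (*-comm n k) (cong (_* n) (sym (m+[n∸m]≡n (>-nonZero⁻¹ k))))
  lhs : ((+ 1 / (2 * n)) ^ℚ k) ℚ.* (½ ^ℚ a) ≡ + (1 ^ k * 1 ^ a) / ((2 * n) ^ k * 2 ^ a)
  lhs = trans (cong₂ ℚ._*_ (/-^ 1 (2 * n) k) (/-^ 1 2 a)) (/-*-/ (1 ^ k) ((2 * n) ^ k) (1 ^ a) (2 ^ a))
  rhs : PrPPZ F (good? k F z₀) ^ℚ k ≡ + (G ^ k) / (N ^ k)
  rhs = trans (cong (_^ℚ k) (Pr-nonEmpty (samples n) (λ (y , π) → good? k F z₀ (ppz F y π)))) (/-^ G N k)
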